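{- Let $t$ be an integer greater than $3$ and let \[ Q_t(a,b,c,d)=2ta^2+\frac{t}{2}b^2+tc^2+td^2+2tab+2tac+2tad+tbc+tbd+tcd. \] Then, as formal power series in $q$, \[ \prod_{\substack{n\ge 1\\ n\equiv 0,\,t-1,\,t,\,t+1 \ (\mathrm{mod}\ 2t)}}(1+q^n) \;=\; \sum_{a=0}^{\infty}\sum_{b=0}^{\infty}\sum_{c=0}^{\infty}\sum_{d=0}^{\infty} \frac{q^{Q_t(a,b,c,d)+\frac{t}{2}b-c+d}}{(q^{2t},q^{2t})_a\,(q^t,q^t)_b\,(q^t,q^t)_c\,(q^t,q^t)_d}. \] Moreover, the left-hand side is the generating function of the partitions into distinct parts each congruent to $0$, $t-1$, $t$ or $t+1$ modulo $2t$, and the right-hand side is the generating function of the partitions into distinct parts, each greater than $1$ and congruent to $0$, $1$ or $-1$ modulo $t$, such that the difference between any two consecutive parts is at least $t+1$ unless both of these parts are congruent to $0$ modulo $t$ or their sum is congruent to $0$ modulo $2t$.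
   Context: For a nonnegative integer $n$, $(x,q)_n=\prod_{i=0}^{n-1}(1-xq^i)$ denotes the $q$-Pochhammer symbol, with $(x,q)_0=1$; thus for example $(q^{t},q^{t})_b=\prod_{i=1}^{b}(1-q^{ti})$ and $(q^{2t},q^{2t})_a=\prod_{i=1}^{a}(1-q^{2ti})$. The generating function of a class of integer partitions is the formal power series $\sum_{n\ge 0}p(n)q^n$, where $p(n)$ is the number of partitions of $n$ in the class (the empty partition being the only partition of $0$). Two parts of a partition into distinct parts are consecutive if they are adjacent when the parts are listed in order of size. -}

module Defs where

open import Data.Bool.Base using (if_then_else_)
open import Data.Integer.Base as ℤ using (ℤ; +_; 0ℤ; 1ℤ; -1ℤ)
import Data.Integer.Properties as ℤₚ
open import Data.List.Base using (List; []; _∷_; applyUpTo; upTo; length)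
open import Data.List.Membership.Propositional using (_∈_; _∉_)
open import Data.List.Relation.Unary.All using (All)
open import Data.List.Relation.Unary.Linked using (Linked)
open import Data.List.Relation.Unary.Unique.Propositional using (Unique)
open import Data.Nat.Base as ℕ
  using (ℕ; zero; suc; _+_; _*_; _∸_; _/_; _≤_; _≥_; _>_; z≤n)
import Data.Nat.Divisibility as ℕ
import Data.Nat.DivMod as ℕ
open import Data.Nat.ListAction using (sum)
import Data.Nat.Properties as ℕₚ
open import Data.Nat.Solver using (module +-*-Solver)
open import Data.Product.Base using (∃-syntax; _×_; _,_)
open import Data.Rational.Base as ℚ using (½)
import Data.Rational.Properties as ℚₚ
import Data.Rational.Solver as ℚ-Solver
import Data.Rational.Unnormalised.Base as ℚᵘ
import Data.Rational.Unnormalised.Properties as ℚᵘₚ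
open import Data.Sum.Base using (_⊎_)
open import Data.Vec.Base using (Vec; []; _∷_; head)
open import Function.Base using (_∘_)
open import Function.Bundles using (_⇔_)
open import Relation.Binary.PropositionalEquality
  using (_≡_; refl; sym; trans; cong; cong₂; subst; module ≡-Reasoning)
open import Relation.Nullary.Decidable.Core using (Dec; does; _⊎-dec_)

∑ : ∀ {i} {I : Set i} → List I → (I → ℤ) → ℤ
∑ []       f = 0ℤ
∑ (x ∷ xs) f = f x ℤ.+ ∑ xs f

-- The value at n is the coefficient of qⁿ; equality is coefficientwise.
PowerSeries : Set
PowerSeries = ℕ → ℤ

infix  4 _≈_
infixl 6 _+ˢ_ _-ˢ_
infixl 7 _*ˢ_ _/ˢ_
infixr 8 _^ˢ_
infix  9 q^_

_≈_ : PowerSeries → PowerSeries → Set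
f ≈ g = ∀ n → f n ≡ g n

q^_ : ℕ → PowerSeries
(q^ e) n = if does (e ℕₚ.≟ n) then 1ℤ else 0ℤ

1ˢ : PowerSeries
1ˢ = q^ 0

_+ˢ_ : PowerSeries → PowerSeries → PowerSeries
(f +ˢ g) n = f n ℤ.+ g n

_-ˢ_ : PowerSeries → PowerSeries → PowerSeries
(f -ˢ g) n = f n ℤ.- g n

_*ˢ_ : PowerSeries → PowerSeries → PowerSeries
(f *ˢ g) n = ∑ (upTo (suc n)) λ i → f i ℤ.* g (n ∸ i)

_^ˢ_ : PowerSeries → ℕ → PowerSeries
f ^ˢ zero  = 1ˢ
f ^ˢ suc n = f ^ˢ n *ˢ f

-- ∏< m f = f 0 ⋯ f (m - 1)
∏< : ℕ → (ℕ → PowerSeries) → PowerSeries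
∏< zero    f = 1ˢ
∏< (suc m) f = ∏< m f *ˢ f m

-- The reciprocal of a series f with constant term 1 (see *ˢ-recip), from
-- g 0 = 1 and g (n + 1) = - Σ_{i ≤ n} f (i + 1) g (n - i).
-- recipCoeffs f n lists g n, g (n - 1), …, g 0.

dot : ∀ {n} → PowerSeries → Vec ℤ n → ℤ
dot f []       = 0ℤ
dot f (x ∷ xs) = f 0 ℤ.* x ℤ.+ dot (f ∘ suc) xs

recipCoeffs : PowerSeries → (n : ℕ) → Vec ℤ (suc n)
recipCoeffs f zero    = 1ℤ ∷ []
recipCoeffs f (suc n) = ℤ.- dot (f ∘ suc) (recipCoeffs f n) ∷ recipCoeffs f n

recip : PowerSeries → PowerSeries
recip f n = head (recipCoeffs f n)

_/ˢ_ : PowerSeries → PowerSeries → PowerSeries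
f /ˢ g = f *ˢ recip g

private
  ∑-shift : ∀ (e : ℕ → ℕ) n (h : ℕ → ℤ) →
            ∑ (applyUpTo e n) (h ∘ suc) ≡ ∑ (applyUpTo (suc ∘ e) n) h
  ∑-shift e zero    h = refl
  ∑-shift e (suc n) h = cong (λ z → h (suc (e 0)) ℤ.+ z) (∑-shift (e ∘ suc) n h)

  dot-recip : ∀ f g n → dot f (recipCoeffs g n) ≡ (f *ˢ recip g) n
  dot-recip f g zero    = refl
  dot-recip f g (suc n) = cong (λ z → f 0 ℤ.* recip g (suc n) ℤ.+ z)
    (trans (dot-recip (f ∘ suc) g n)
           (∑-shift (λ i → i) (suc n) λ i → f i ℤ.* recip g (suc n ∸ i)))

*ˢ-recip : ∀ f → f 0 ≡ 1ℤ → f *ˢ recip f ≈ 1ˢ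
*ˢ-recip f f0 zero    rewrite f0 = refl
*ˢ-recip f f0 (suc n) = trans (sym (dot-recip f f (suc n))) (begin
  f 0 ℤ.* (ℤ.- s) ℤ.+ s ≡⟨ cong (λ z → z ℤ.* (ℤ.- s) ℤ.+ s) f0 ⟩
  1ℤ ℤ.* (ℤ.- s) ℤ.+ s  ≡⟨ cong (ℤ._+ s) (ℤₚ.*-identityˡ (ℤ.- s)) ⟩
  ℤ.- s ℤ.+ s           ≡⟨ ℤₚ.+-inverseˡ s ⟩
  0ℤ                    ∎)
  where
  open ≡-Reasoning
  s = dot (f ∘ suc) (recipCoeffs f n)

-- ∏_{k ≥ 0} f k = F: every coefficient of the partial products is
-- eventually constant, with the coefficient of F as its final value.
HasProduct : (ℕ → PowerSeries) → PowerSeries → Set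
HasProduct f F = ∀ n → ∃[ M ] ∀ m → m ≥ M → ∏< m f n ≡ F n

-- Σ_{i ∈ I} f i = F: for every n, only finitely many terms contribute to
-- the coefficient of qⁿ, and their contributions add up to that of F.
HasSum : {I : Set} → (I → PowerSeries) → PowerSeries → Set
HasSum {I} f F = ∀ n → ∃[ S ]
  Unique S × (∀ (i : I) → i ∉ S → f i n ≡ 0ℤ) × ∑ S (λ i → f i n) ≡ F n

-- Parts are listed in decreasing order.
DistinctPartition : ℕ → List ℕ → Set
DistinctPartition n ps = Linked _>_ ps × All (_> 0) ps × sum ps ≡ n

HasCardinality : {A : Set} → (A → Set) → ℕ → Set
HasCardinality P k = ∃[ xs ] Unique xs × (∀ x → x ∈ xs ⇔ P x) × length xs ≡ k

-- Distinctness of the parts is built in, so C states only the further conditions.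
IsGeneratingFunction : (List ℕ → Set) → PowerSeries → Set
IsGeneratingFunction C F = ∀ n → ∃[ p ]
  HasCardinality (λ ps → DistinctPartition n ps × C ps) p × F n ≡ + p

infix 4 _≅_[mod_]

_≅_[mod_] : ℕ → ℤ → ℕ → Set
n ≅ r [mod m ] = m ℕ.∣ ℤ.∣ + n ℤ.- r ∣

_≅?_[mod_] : ∀ n r m → Dec (n ≅ r [mod m ])
n ≅? r [mod m ] = m ℕ.∣? ℤ.∣ + n ℤ.- r ∣

ProductResidue : ℕ → ℕ → Set
ProductResidue t n =
    n ≅ 0ℤ         [mod 2 * t ]
  ⊎ n ≅ + t ℤ.- 1ℤ [mod 2 * t ]
  ⊎ n ≅ + t        [mod 2 * t ]
  ⊎ n ≅ + t ℤ.+ 1ℤ [mod 2 * t ]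

productResidue? : ∀ t n → Dec (ProductResidue t n)
productResidue? t n =
        (n ≅? 0ℤ         [mod 2 * t ])
  ⊎-dec (n ≅? + t ℤ.- 1ℤ [mod 2 * t ])
  ⊎-dec (n ≅? + t        [mod 2 * t ])
  ⊎-dec (n ≅? + t ℤ.+ 1ℤ [mod 2 * t ])

productFactor : ℕ → ℕ → PowerSeries
productFactor t n = if does (productResidue? t n) then 1ˢ +ˢ q^ n else 1ˢ

ProductClass : ℕ → List ℕ → Set
ProductClass t ps = All (ProductResidue t) ps

qPochhammer : PowerSeries → PowerSeries → ℕ → PowerSeries
qPochhammer x q n = ∏< n λ i → 1ˢ -ˢ x *ˢ q ^ˢ i

⌜_⌝ : ℕ → ℚ.ℚ
⌜ n ⌝ = + n ℚ./ 1

Q : (t a b c d : ℕ) → ℚ.ℚ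
Q t a b c d =
  ⌜ 2 ⌝ ℚ.* T ℚ.* A ℚ.* A ℚ.+ ½ ℚ.* T ℚ.* B ℚ.* B ℚ.+ T ℚ.* C ℚ.* C ℚ.+ T ℚ.* D ℚ.* D
  ℚ.+ ⌜ 2 ⌝ ℚ.* T ℚ.* A ℚ.* B ℚ.+ ⌜ 2 ⌝ ℚ.* T ℚ.* A ℚ.* C ℚ.+ ⌜ 2 ⌝ ℚ.* T ℚ.* A ℚ.* D
  ℚ.+ T ℚ.* B ℚ.* C ℚ.+ T ℚ.* B ℚ.* D ℚ.+ T ℚ.* C ℚ.* D
  where
  T = ⌜ t ⌝
  A = ⌜ a ⌝
  B = ⌜ b ⌝
  C = ⌜ c ⌝
  D = ⌜ d ⌝

-- Q t a b c d + (t/2) b - c + d as a natural number (see exponent-correct):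
-- the half-integral terms combine to t b (b + 1) / 2.
exponent : (t a b c d : ℕ) → ℕ
exponent t a b c d =
  2 * t * a * a + t * (b * suc b / 2) + (t * c * c ∸ c) + (t * d * d + d)
  + 2 * t * a * b + 2 * t * a * c + 2 * t * a * d
  + t * b * c + t * b * d + t * c * d

private
  2∣b[b+1] : ∀ b → 2 ℕ.∣ b * suc b
  2∣b[b+1] zero    = 2 ℕ.∣0
  2∣b[b+1] (suc b) = subst (2 ℕ.∣_) (eq b)
    (ℕ.∣m∣n⇒∣m+n (2∣b[b+1] b) (ℕ.m∣m*n (suc b)))
    where
    eq : ∀ b → b * suc b + 2 * suc b ≡ suc b * suc (suc b)
    eq = solve 1 (λ b → b :* (con 1 :+ b) :+ con 2 :* (con 1 :+ b)
                        := (con 1 :+ b) :* (con 2 :+ b)) refl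
      where open +-*-Solver

  toℚᵘ-⌜⌝ : ∀ n → ℚ.toℚᵘ ⌜ n ⌝ ℚᵘ.≃ ℚᵘ.mkℚᵘ (+ n) 0
  toℚᵘ-⌜⌝ n = ℚₚ.toℚᵘ-fromℚᵘ (ℚᵘ.mkℚᵘ (+ n) 0)

  ⌜⌝-+ : ∀ m n → ⌜ m + n ⌝ ≡ ⌜ m ⌝ ℚ.+ ⌜ n ⌝
  ⌜⌝-+ m n = ℚₚ.toℚᵘ-injective (begin
    ℚ.toℚᵘ ⌜ m + n ⌝                          ≈⟨ toℚᵘ-⌜⌝ (m + n) ⟩
    ℚᵘ.mkℚᵘ (+ (m + n)) 0                     ≈⟨ ℚᵘ.*≡* (cong (ℤ._* + 1) (sym (cong₂ ℤ._+_ (ℤₚ.*-identityʳ (+ m)) (ℤₚ.*-identityʳ (+ n))))) ⟩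
    ℚᵘ.mkℚᵘ (+ m) 0 ℚᵘ.+ ℚᵘ.mkℚᵘ (+ n) 0      ≈⟨ ℚᵘₚ.+-cong (toℚᵘ-⌜⌝ m) (toℚᵘ-⌜⌝ n) ⟨
    ℚ.toℚᵘ ⌜ m ⌝ ℚᵘ.+ ℚ.toℚᵘ ⌜ n ⌝            ≈⟨ ℚₚ.toℚᵘ-homo-+ ⌜ m ⌝ ⌜ n ⌝ ⟨
    ℚ.toℚᵘ (⌜ m ⌝ ℚ.+ ⌜ n ⌝)                  ∎)
    where open ℚᵘₚ.≃-Reasoning

  ⌜⌝-* : ∀ m n → ⌜ m * n ⌝ ≡ ⌜ m ⌝ ℚ.* ⌜ n ⌝
  ⌜⌝-* m n = ℚₚ.toℚᵘ-injective (begin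
    ℚ.toℚᵘ ⌜ m * n ⌝                          ≈⟨ toℚᵘ-⌜⌝ (m * n) ⟩
    ℚᵘ.mkℚᵘ (+ (m * n)) 0                     ≈⟨ ℚᵘ.*≡* (cong (ℤ._* + 1) (ℤₚ.pos-* m n)) ⟩
    ℚᵘ.mkℚᵘ (+ m) 0 ℚᵘ.* ℚᵘ.mkℚᵘ (+ n) 0      ≈⟨ ℚᵘₚ.*-cong (toℚᵘ-⌜⌝ m) (toℚᵘ-⌜⌝ n) ⟨
    ℚ.toℚᵘ ⌜ m ⌝ ℚᵘ.* ℚ.toℚᵘ ⌜ n ⌝            ≈⟨ ℚₚ.toℚᵘ-homo-* ⌜ m ⌝ ⌜ n ⌝ ⟨
    ℚ.toℚᵘ (⌜ m ⌝ ℚ.* ⌜ n ⌝)                  ∎)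
    where open ℚᵘₚ.≃-Reasoning

  ⌜⌝-*₃ : ∀ k m n → ⌜ k * m * n ⌝ ≡ ⌜ k ⌝ ℚ.* ⌜ m ⌝ ℚ.* ⌜ n ⌝
  ⌜⌝-*₃ k m n = trans (⌜⌝-* (k * m) n) (cong (ℚ._* ⌜ n ⌝) (⌜⌝-* k m))

  ⌜⌝-*₄ : ∀ j k m n → ⌜ j * k * m * n ⌝ ≡ ⌜ j ⌝ ℚ.* ⌜ k ⌝ ℚ.* ⌜ m ⌝ ℚ.* ⌜ n ⌝
  ⌜⌝-*₄ j k m n = trans (⌜⌝-* (j * k * m) n) (cong (ℚ._* ⌜ n ⌝) (⌜⌝-*₃ j k m))

  ⌜⌝-∸ : ∀ {m n} → n ≤ m → ⌜ m ∸ n ⌝ ≡ ⌜ m ⌝ ℚ.- ⌜ n ⌝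
  ⌜⌝-∸ {m} {n} n≤m = begin
    ⌜ m ∸ n ⌝                        ≡⟨ lem ⌜ m ∸ n ⌝ ⌜ n ⌝ ⟩
    (⌜ m ∸ n ⌝ ℚ.+ ⌜ n ⌝) ℚ.- ⌜ n ⌝  ≡⟨ cong (ℚ._- ⌜ n ⌝) (⌜⌝-+ (m ∸ n) n) ⟨
    ⌜ m ∸ n + n ⌝ ℚ.- ⌜ n ⌝          ≡⟨ cong (λ k → ⌜ k ⌝ ℚ.- ⌜ n ⌝) (ℕₚ.m∸n+n≡m n≤m) ⟩
    ⌜ m ⌝ ℚ.- ⌜ n ⌝                  ∎
    where
    open ≡-Reasoning
    lem : ∀ x y → x ≡ (x ℚ.+ y) ℚ.- y
    lem = solve 2 (λ x y → x := (x :+ y) :- y) refl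
      where open ℚ-Solver.+-*-Solver

  ⌜⌝-triangle : ∀ b → ⌜ b * suc b / 2 ⌝ ≡ ½ ℚ.* (⌜ b ⌝ ℚ.* ⌜ b ⌝ ℚ.+ ⌜ b ⌝)
  ⌜⌝-triangle b = begin
    ⌜ k ⌝                                ≡⟨ lem ⌜ k ⌝ ⟩
    ½ ℚ.* (⌜ k ⌝ ℚ.* ⌜ 2 ⌝)              ≡⟨ cong (½ ℚ.*_) (⌜⌝-* k 2) ⟨
    ½ ℚ.* ⌜ k * 2 ⌝                      ≡⟨ cong (λ n → ½ ℚ.* ⌜ n ⌝) (ℕ.m/n*n≡m (2∣b[b+1] b)) ⟩
    ½ ℚ.* ⌜ b * suc b ⌝                  ≡⟨ cong (λ n → ½ ℚ.* ⌜ n ⌝) (trans (ℕₚ.*-suc b b) (ℕₚ.+-comm b (b * b))) ⟩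
    ½ ℚ.* ⌜ b * b + b ⌝                  ≡⟨ cong (½ ℚ.*_) (trans (⌜⌝-+ (b * b) b) (cong (ℚ._+ ⌜ b ⌝) (⌜⌝-* b b))) ⟩
    ½ ℚ.* (⌜ b ⌝ ℚ.* ⌜ b ⌝ ℚ.+ ⌜ b ⌝)    ∎
    where
    open ≡-Reasoning
    k = b * suc b / 2
    lem : ∀ x → x ≡ ½ ℚ.* (x ℚ.* ⌜ 2 ⌝)
    lem = solve 1 (λ x → x := con ½ :* (x :* con ⌜ 2 ⌝)) refl
      where open ℚ-Solver.+-*-Solver

  c≤tcc : ∀ {t} c → t > 0 → c ≤ t * c * c
  c≤tcc             zero      t>0 = z≤n
  c≤tcc {t = suc t} c@(suc _) t>0 = ℕₚ.m≤n*m c (suc t * c)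

private
  record CastsTo (n : ℕ) (x : ℚ.ℚ) : Set where
    constructor casts
    field value : ⌜ n ⌝ ≡ x
  open CastsTo

exponent-correct : ∀ {t} a b c d → t > 0 →
  ⌜ exponent t a b c d ⌝ ≡ Q t a b c d ℚ.+ ½ ℚ.* ⌜ t ⌝ ℚ.* ⌜ b ⌝ ℚ.- ⌜ c ⌝ ℚ.+ ⌜ d ⌝
exponent-correct {t} a b c d t>0 = trans (value
  (*₄ 2 t a a
    ⊕ casts (trans (⌜⌝-* t (b * suc b / 2)) (cong (ℚ._*_ ⌜ t ⌝) (⌜⌝-triangle b)))
    ⊕ casts (trans (⌜⌝-∸ (c≤tcc c t>0)) (cong (ℚ._- ⌜ c ⌝) (⌜⌝-*₃ t c c)))
    ⊕ (*₃ t d d ⊕ casts refl)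
    ⊕ *₄ 2 t a b ⊕ *₄ 2 t a c ⊕ *₄ 2 t a d
    ⊕ *₃ t b c ⊕ *₃ t b d ⊕ *₃ t c d))
  (lem ⌜ t ⌝ ⌜ a ⌝ ⌜ b ⌝ ⌜ c ⌝ ⌜ d ⌝)
  where
  infixl 6 _⊕_
  _⊕_ : ∀ {m n x y} → CastsTo m x → CastsTo n y → CastsTo (m + n) (x ℚ.+ y)
  _⊕_ {m} {n} (casts p) (casts r) = casts (trans (⌜⌝-+ m n) (cong₂ ℚ._+_ p r))

  *₃ : ∀ k m n → CastsTo (k * m * n) (⌜ k ⌝ ℚ.* ⌜ m ⌝ ℚ.* ⌜ n ⌝)
  *₃ k m n = casts (⌜⌝-*₃ k m n)

  *₄ : ∀ j k m n → CastsTo (j * k * m * n) (⌜ j ⌝ ℚ.* ⌜ k ⌝ ℚ.* ⌜ m ⌝ ℚ.* ⌜ n ⌝)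
  *₄ j k m n = casts (⌜⌝-*₄ j k m n)

  lem : ∀ T A B C D →
    ⌜ 2 ⌝ ℚ.* T ℚ.* A ℚ.* A ℚ.+ T ℚ.* (½ ℚ.* (B ℚ.* B ℚ.+ B)) ℚ.+ (T ℚ.* C ℚ.* C ℚ.- C) ℚ.+ (T ℚ.* D ℚ.* D ℚ.+ D)
    ℚ.+ ⌜ 2 ⌝ ℚ.* T ℚ.* A ℚ.* B ℚ.+ ⌜ 2 ⌝ ℚ.* T ℚ.* A ℚ.* C ℚ.+ ⌜ 2 ⌝ ℚ.* T ℚ.* A ℚ.* D
    ℚ.+ T ℚ.* B ℚ.* C ℚ.+ T ℚ.* B ℚ.* D ℚ.+ T ℚ.* C ℚ.* D
    ≡
    (⌜ 2 ⌝ ℚ.* T ℚ.* A ℚ.* A ℚ.+ ½ ℚ.* T ℚ.* B ℚ.* B ℚ.+ T ℚ.* C ℚ.* C ℚ.+ T ℚ.* D ℚ.* D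
    ℚ.+ ⌜ 2 ⌝ ℚ.* T ℚ.* A ℚ.* B ℚ.+ ⌜ 2 ⌝ ℚ.* T ℚ.* A ℚ.* C ℚ.+ ⌜ 2 ⌝ ℚ.* T ℚ.* A ℚ.* D
    ℚ.+ T ℚ.* B ℚ.* C ℚ.+ T ℚ.* B ℚ.* D ℚ.+ T ℚ.* C ℚ.* D)
    ℚ.+ ½ ℚ.* T ℚ.* B ℚ.- C ℚ.+ D
  lem = solve 5 (λ T A B C D →
    con ⌜ 2 ⌝ :* T :* A :* A :+ T :* (con ½ :* (B :* B :+ B)) :+ (T :* C :* C :- C)
    :+ (T :* D :* D :+ D)
    :+ con ⌜ 2 ⌝ :* T :* A :* B :+ con ⌜ 2 ⌝ :* T :* A :* C :+ con ⌜ 2 ⌝ :* T :* A :* D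
    :+ T :* B :* C :+ T :* B :* D :+ T :* C :* D
    :=
    (con ⌜ 2 ⌝ :* T :* A :* A :+ con ½ :* T :* B :* B :+ T :* C :* C :+ T :* D :* D
    :+ con ⌜ 2 ⌝ :* T :* A :* B :+ con ⌜ 2 ⌝ :* T :* A :* C :+ con ⌜ 2 ⌝ :* T :* A :* D
    :+ T :* B :* C :+ T :* B :* D :+ T :* C :* D)
    :+ con ½ :* T :* B :- C :+ D) refl
    where open ℚ-Solver.+-*-Solver

denominator : (t a b c d : ℕ) → PowerSeries
denominator t a b c d =
     qPochhammer (q^ (2 * t)) (q^ (2 * t)) a
  *ˢ qPochhammer (q^ t) (q^ t) b
  *ˢ qPochhammer (q^ t) (q^ t) c
  *ˢ qPochhammer (q^ t) (q^ t) d

private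
  *ˢ-constant : ∀ f g → f 0 ≡ 1ℤ → g 0 ≡ 1ℤ → (f *ˢ g) 0 ≡ 1ℤ
  *ˢ-constant f g f0 g0 rewrite f0 | g0 = refl

  qPochhammer-constant : ∀ t n → qPochhammer (q^ suc t) (q^ suc t) n 0 ≡ 1ℤ
  qPochhammer-constant t zero    = refl
  qPochhammer-constant t (suc n) =
    *ˢ-constant (qPochhammer x x n) (1ˢ -ˢ x *ˢ x ^ˢ n) (qPochhammer-constant t n) refl
    where x = q^ suc t

denominator-constant : ∀ {t} a b c d → t > 0 → denominator t a b c d 0 ≡ 1ℤ
denominator-constant {suc t} a b c d _ =
  *ˢ-constant (A *ˢ B *ˢ C) D
    (*ˢ-constant (A *ˢ B) C
      (*ˢ-constant A B (qPochhammer-constant _ a) (qPochhammer-constant t b))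
      (qPochhammer-constant t c))
    (qPochhammer-constant t d)
  where
  A = qPochhammer (q^ (2 * suc t)) (q^ (2 * suc t)) a
  B = qPochhammer (q^ suc t) (q^ suc t) b
  C = qPochhammer (q^ suc t) (q^ suc t) c
  D = qPochhammer (q^ suc t) (q^ suc t) d

summand : ℕ → ℕ × ℕ × ℕ × ℕ → PowerSeries
summand t (a , b , c , d) = q^ exponent t a b c d /ˢ denominator t a b c d

SumResidue : ℕ → ℕ → Set
SumResidue t n =
  n ≅ 0ℤ [mod t ] ⊎ n ≅ 1ℤ [mod t ] ⊎ n ≅ -1ℤ [mod t ]

-- Only applied to consecutive parts x > y, so that ∸ is their difference.
Separated : ℕ → ℕ → ℕ → Set
Separated t x y =
    x ∸ y ≥ t + 1
  ⊎ (x ≅ 0ℤ [mod t ] × y ≅ 0ℤ [mod t ])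
  ⊎ x + y ≅ 0ℤ [mod 2 * t ]

SumClass : ℕ → List ℕ → Set
SumClass t ps =
  All (_> 1) ps × All (SumResidue t) ps × Linked (Separated t) ps

{-# OPTIONS --safe #-}

-- Write Q = q^t and x = q, so that the parts tk - 1, tk, tk + 1 have weights Q^k / x, Q^k, x Q^k, and let
-- f i j k l be the quadruple sum with its summand multiplied by Q^(i a + j b + k c + l d).
-- Cancelling one factor of one q-Pochhammer symbol at a time gives four q-difference equations for f:
--   f i j k l = f (i + 2) j k l + Q^(i + 2)     f (i + 4) (j + 2) (k + 2) (l + 2)
--             = f i (j + 1) k l + Q^(j + 1)     f (i + 2) (j + 1) (k + 1) (l + 1)
--             = f i j (k + 1) l + Q^(k + 1) / x f (i + 2) (j + 1) (k + 2) (l + 1)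
--             = f i j k (l + 1) + x Q^(l + 1)   f (i + 2) (j + 1) (k + 1) (l + 2).
-- They contain the recurrences, by smallest part, of the partitions with difference conditions.
-- They also imply f (k + l) 0 k l = (1 + x Q^(l + 1)) f (k + l + 2) 0 k (l + 2) and its mirror image
-- in k and l; iterating both from f 0 0 0 0, and then the second equation with i = k = l = ∞, splits
-- off all factors of the infinite product.

module Submission where

open import Defs
open import Algebra.Bundles using (CommutativeMonoid)
import Algebra.Properties.CommutativeSemigroup as CommutativeSemigroupProperties
open import Data.Bool.Base using (if_then_else_)
open import Data.Integer.Base as ℤ using (ℤ; 0ℤ; 1ℤ)
import Data.Integer.Properties as ℤₚ
import Data.Integer.Tactic.RingSolver as ℤ-Ring
open import Data.List.Base
  using (List; []; _∷_; _++_; map; applyUpTo; upTo; cartesianProduct; reverse; _ʳ++_)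
import Data.List.Properties as Listₚ
open import Data.List.Membership.Propositional using (_∈_; _∉_)
open import Data.List.Membership.Propositional.Properties
  using (∈-cartesianProduct⁺; ∈-upTo⁺; ∈-map⁺; ∈-map⁻; ∈-++⁺ˡ; ∈-++⁺ʳ; ∈-++⁻)
open import Data.List.Relation.Binary.Permutation.Propositional using (↭-sym)
open import Data.List.Relation.Binary.Permutation.Propositional.Properties using (All-resp-↭; ↭-reverse)
open import Data.List.Relation.Unary.All as All using (All; []; _∷_)
open import Data.List.Relation.Unary.AllPairs using ([]; _∷_)
open import Data.List.Relation.Unary.Any using (here; there)
open import Data.List.Relation.Unary.Linked as Linked using (Linked; []; [-]; _∷_)
open import Data.List.Relation.Unary.Unique.Propositional using (Unique)
import Data.List.Relation.Unary.Unique.Propositional.Properties as Uniqueₚ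
open import Data.Nat.Base
  using (ℕ; zero; suc; _+_; _*_; _∸_; _/_; _%_; _≤_; _<_; _>_; z≤n; s≤s; z<s; s<s; NonZero)
open import Data.Nat.Divisibility using (_∣_; divides; n∣m*n)
open import Data.Nat.DivMod using ([m+kn]%n≡m%n; m<n⇒m%n≡m; +-distrib-/-∣ʳ; m*n/n≡m)
open import Data.Nat.ListAction using (sum)
open import Data.Nat.ListAction.Properties using (sum-↭)
import Data.Nat.Properties as ℕₚ
import Data.Nat.Tactic.RingSolver as ℕ-Ring
open import Data.Product.Base using (_×_; _,_; ∃-syntax; proj₁; proj₂)
open import Data.Sum.Base using (_⊎_; inj₁; inj₂; [_,_]′)
open import Data.Unit.Base using (⊤; tt)
open import Function.Base using (id; flip; _∘_)
open import Function.Bundles using (_⇔_; mk⇔; Equivalence)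
open import Function.Construct.Symmetry using (⇔-sym)
open import Level using (0ℓ)
open import Relation.Binary.Definitions using (tri<; tri≈; tri>)
open import Relation.Binary.PropositionalEquality
  using (_≡_; _≢_; refl; sym; trans; cong; cong₂; subst; module ≡-Reasoning)
import Relation.Binary.Reasoning.Setoid as SetoidReasoning
open import Relation.Nullary using (¬_; Dec; yes; no; contradiction)
open import Relation.Nullary.Decidable using (dec-true; dec-false)

open Equivalence using (to; from)

-- The ring of power series

-- The four summation indices count objects. Here `a` counts the pairs tk - 1, tk + 1 that occur
-- together (the exception for sums divisible by 2t), `b` the multiples of t, and `c` and `d` the
-- remaining parts congruent to -1 and 1 modulo t. The second term of each q-difference equation
-- adjoins one such object; a pair weighs Q^(2k), which is why the equation in `a` carries Q^(i +
-- 2). The same weight governs the factorization. The product of Q^(k + 1) / x and x Q^(l + 1) is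
-- Q^(k + l + 2), which is Q^(i + 2) exactly when i = k + l. On this slice a correction from `c`
-- followed by `d` merges with one from `a`. Splitting off a factor raises k or l by 2, so only
-- every other multiple of t gets neighbours in the product: this is the origin of the modulus 2t.
-- Neither the product nor the recurrences by smallest part terminate. Both are therefore treated
-- below an arbitrary degree N, where parameters of size at least N act as infinity.

∑-applyUpTo-∘ : ∀ (e : ℕ → ℕ) n (h : ℕ → ℤ) →
                ∑ (applyUpTo e n) h ≡ ∑ (upTo n) (h ∘ e)
∑-applyUpTo-∘ e zero    h = refl
∑-applyUpTo-∘ e (suc n) h = cong (λ z → h (e 0) ℤ.+ z)
  (trans (∑-applyUpTo-∘ (e ∘ suc) n h) (sym (∑-applyUpTo-∘ suc n (h ∘ e))))

∑-upTo-suc : ∀ n (h : ℕ → ℤ) → ∑ (upTo (suc n)) h ≡ h 0 ℤ.+ ∑ (upTo n) (h ∘ suc)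
∑-upTo-suc n h = cong (λ z → h 0 ℤ.+ z) (∑-applyUpTo-∘ suc n h)

*ˢ-coeff-zero : ∀ f g → (f *ˢ g) 0 ≡ f 0 ℤ.* g 0
*ˢ-coeff-zero f g = ℤₚ.+-identityʳ _

*ˢ-coeff-suc : ∀ f g n → (f *ˢ g) (suc n) ≡ f 0 ℤ.* g (suc n) ℤ.+ ((f ∘ suc) *ˢ g) n
*ˢ-coeff-suc f g n = ∑-upTo-suc (suc n) λ i → f i ℤ.* g (suc n ∸ i)

-- A coefficient of a product involves no higher coefficients of its factors. This bounded form is
-- what later permits multiplication modulo a power of q.
*ˢ-local : ∀ {f f′ g g′} n → (∀ m → m ≤ n → f m ≡ f′ m) → (∀ m → m ≤ n → g m ≡ g′ m) →
           (f *ˢ g) n ≡ (f′ *ˢ g′) n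
*ˢ-local {f} {f′} {g} {g′} zero p r =
  cong₂ (λ x y → x ℤ.* y ℤ.+ 0ℤ) (p 0 z≤n) (r 0 z≤n)
*ˢ-local {f} {f′} {g} {g′} (suc n) p r = begin
  (f *ˢ g) (suc n)
    ≡⟨ *ˢ-coeff-suc f g n ⟩
  f 0 ℤ.* g (suc n) ℤ.+ ((f ∘ suc) *ˢ g) n
    ≡⟨ cong₂ ℤ._+_ (cong₂ ℤ._*_ (p 0 z≤n) (r (suc n) ℕₚ.≤-refl))
         (*ˢ-local n (λ m m≤n → p (suc m) (s≤s m≤n)) (λ m m≤n → r m (ℕₚ.m≤n⇒m≤1+n m≤n))) ⟩
  f′ 0 ℤ.* g′ (suc n) ℤ.+ ((f′ ∘ suc) *ˢ g′) n
    ≡⟨ *ˢ-coeff-suc f′ g′ n ⟨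
  (f′ *ˢ g′) (suc n) ∎
  where open ≡-Reasoning

*ˢ-cong : ∀ {f f′ g g′} → f ≈ f′ → g ≈ g′ → f *ˢ g ≈ f′ *ˢ g′
*ˢ-cong p r n = *ˢ-local n (λ m _ → p m) (λ m _ → r m)

*ˢ-congˡ : ∀ f {g g′} → g ≈ g′ → f *ˢ g ≈ f *ˢ g′
*ˢ-congˡ f p = *ˢ-cong {f} {f} (λ _ → refl) p

*ˢ-congʳ : ∀ g {f f′} → f ≈ f′ → f *ˢ g ≈ f′ *ˢ g
*ˢ-congʳ g p = *ˢ-cong {g = g} {g} p (λ _ → refl)

*ˢ-zeroˡ : ∀ g → (λ _ → 0ℤ) *ˢ g ≈ λ _ → 0ℤ
*ˢ-zeroˡ g zero    = refl
*ˢ-zeroˡ g (suc n) = trans (*ˢ-coeff-suc (λ _ → 0ℤ) g n) (trans (ℤₚ.+-identityˡ _) (*ˢ-zeroˡ g n))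

*ˢ-identityˡ : ∀ g → 1ˢ *ˢ g ≈ g
*ˢ-identityˡ g zero    = trans (*ˢ-coeff-zero 1ˢ g) (ℤₚ.*-identityˡ (g 0))
*ˢ-identityˡ g (suc n) = begin
  (1ˢ *ˢ g) (suc n)                               ≡⟨ *ˢ-coeff-suc 1ˢ g n ⟩
  1ℤ ℤ.* g (suc n) ℤ.+ ((λ _ → 0ℤ) *ˢ g) n         ≡⟨ cong₂ ℤ._+_ (ℤₚ.*-identityˡ (g (suc n))) (*ˢ-zeroˡ g n) ⟩
  g (suc n) ℤ.+ 0ℤ                                ≡⟨ ℤₚ.+-identityʳ _ ⟩
  g (suc n)                                       ∎
  where open ≡-Reasoning

-- Peels the Cauchy sum at its other end; commutativity comes from comparing the two peelings.
*ˢ-coeff-sucʳ : ∀ f g n → (f *ˢ g) (suc n) ≡ (f *ˢ (g ∘ suc)) n ℤ.+ f (suc n) ℤ.* g 0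
*ˢ-coeff-sucʳ f g zero    = trans (*ˢ-coeff-suc f g 0) (lem (f 0) (g 1) (f 1) (g 0))
  where
  lem : ∀ a b c d → a ℤ.* b ℤ.+ (c ℤ.* d ℤ.+ 0ℤ) ≡ a ℤ.* b ℤ.+ 0ℤ ℤ.+ c ℤ.* d
  lem = ℤ-Ring.solve-∀
*ˢ-coeff-sucʳ f g (suc n) = begin
  (f *ˢ g) (suc (suc n))
    ≡⟨ *ˢ-coeff-suc f g (suc n) ⟩
  a ℤ.+ ((f ∘ suc) *ˢ g) (suc n)
    ≡⟨ cong (λ z → a ℤ.+ z) (*ˢ-coeff-sucʳ (f ∘ suc) g n) ⟩
  a ℤ.+ (((f ∘ suc) *ˢ (g ∘ suc)) n ℤ.+ b)
    ≡⟨ ℤₚ.+-assoc a _ b ⟨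
  a ℤ.+ ((f ∘ suc) *ˢ (g ∘ suc)) n ℤ.+ b
    ≡⟨ cong (ℤ._+ b) (*ˢ-coeff-suc f (g ∘ suc) n) ⟨
  (f *ˢ (g ∘ suc)) (suc n) ℤ.+ b ∎
  where
  open ≡-Reasoning
  a = f 0 ℤ.* g (suc (suc n))
  b = f (suc (suc n)) ℤ.* g 0

*ˢ-comm : ∀ f g → f *ˢ g ≈ g *ˢ f
*ˢ-comm f g zero    = cong (ℤ._+ 0ℤ) (ℤₚ.*-comm (f 0) (g 0))
*ˢ-comm f g (suc n) = begin
  (f *ˢ g) (suc n)                                ≡⟨ *ˢ-coeff-suc f g n ⟩
  f 0 ℤ.* g (suc n) ℤ.+ ((f ∘ suc) *ˢ g) n        ≡⟨ cong₂ ℤ._+_ (ℤₚ.*-comm (f 0) (g (suc n))) (*ˢ-comm (f ∘ suc) g n) ⟩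
  g (suc n) ℤ.* f 0 ℤ.+ (g *ˢ (f ∘ suc)) n        ≡⟨ ℤₚ.+-comm (g (suc n) ℤ.* f 0) _ ⟩
  (g *ˢ (f ∘ suc)) n ℤ.+ g (suc n) ℤ.* f 0        ≡⟨ *ˢ-coeff-sucʳ g f n ⟨
  (g *ˢ f) (suc n)                                ∎
  where open ≡-Reasoning

*ˢ-distribʳ : ∀ f g h → (f +ˢ g) *ˢ h ≈ f *ˢ h +ˢ g *ˢ h
*ˢ-distribʳ f g h zero    = lem (f 0) (g 0) (h 0)
  where
  lem : ∀ a b c → (a ℤ.+ b) ℤ.* c ℤ.+ 0ℤ ≡ a ℤ.* c ℤ.+ 0ℤ ℤ.+ (b ℤ.* c ℤ.+ 0ℤ)
  lem = ℤ-Ring.solve-∀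
*ˢ-distribʳ f g h (suc n) = begin
  ((f +ˢ g) *ˢ h) (suc n)
    ≡⟨ *ˢ-coeff-suc (f +ˢ g) h n ⟩
  (f 0 ℤ.+ g 0) ℤ.* h (suc n) ℤ.+ (((f ∘ suc) +ˢ (g ∘ suc)) *ˢ h) n
    ≡⟨ cong (λ z → (f 0 ℤ.+ g 0) ℤ.* h (suc n) ℤ.+ z) (*ˢ-distribʳ (f ∘ suc) (g ∘ suc) h n) ⟩
  (f 0 ℤ.+ g 0) ℤ.* h (suc n) ℤ.+ (((f ∘ suc) *ˢ h) n ℤ.+ ((g ∘ suc) *ˢ h) n)
    ≡⟨ lem (f 0) (g 0) (h (suc n)) _ _ ⟩
  f 0 ℤ.* h (suc n) ℤ.+ ((f ∘ suc) *ˢ h) n ℤ.+ (g 0 ℤ.* h (suc n) ℤ.+ ((g ∘ suc) *ˢ h) n)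
    ≡⟨ cong₂ ℤ._+_ (*ˢ-coeff-suc f h n) (*ˢ-coeff-suc g h n) ⟨
  (f *ˢ h) (suc n) ℤ.+ (g *ˢ h) (suc n) ∎
  where
  open ≡-Reasoning
  lem : ∀ a b c d e → (a ℤ.+ b) ℤ.* c ℤ.+ (d ℤ.+ e) ≡ a ℤ.* c ℤ.+ d ℤ.+ (b ℤ.* c ℤ.+ e)
  lem = ℤ-Ring.solve-∀

*ˢ-scaleˡ : ∀ c f g → (λ m → c ℤ.* f m) *ˢ g ≈ λ n → c ℤ.* (f *ˢ g) n
*ˢ-scaleˡ c f g zero    = lem c (f 0) (g 0)
  where
  lem : ∀ a b c → a ℤ.* b ℤ.* c ℤ.+ 0ℤ ≡ a ℤ.* (b ℤ.* c ℤ.+ 0ℤ)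
  lem = ℤ-Ring.solve-∀
*ˢ-scaleˡ c f g (suc n) = begin
  ((λ m → c ℤ.* f m) *ˢ g) (suc n)
    ≡⟨ *ˢ-coeff-suc (λ m → c ℤ.* f m) g n ⟩
  c ℤ.* f 0 ℤ.* g (suc n) ℤ.+ ((λ m → c ℤ.* f (suc m)) *ˢ g) n
    ≡⟨ cong (λ z → c ℤ.* f 0 ℤ.* g (suc n) ℤ.+ z) (*ˢ-scaleˡ c (f ∘ suc) g n) ⟩
  c ℤ.* f 0 ℤ.* g (suc n) ℤ.+ c ℤ.* ((f ∘ suc) *ˢ g) n
    ≡⟨ lem c (f 0) (g (suc n)) _ ⟩
  c ℤ.* (f 0 ℤ.* g (suc n) ℤ.+ ((f ∘ suc) *ˢ g) n)
    ≡⟨ cong (c ℤ.*_) (*ˢ-coeff-suc f g n) ⟨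
  c ℤ.* (f *ˢ g) (suc n) ∎
  where
  open ≡-Reasoning
  lem : ∀ a b c d → a ℤ.* b ℤ.* c ℤ.+ a ℤ.* d ≡ a ℤ.* (b ℤ.* c ℤ.+ d)
  lem = ℤ-Ring.solve-∀

*ˢ-assoc : ∀ f g h → (f *ˢ g) *ˢ h ≈ f *ˢ (g *ˢ h)
*ˢ-assoc f g h zero    = lem (f 0) (g 0) (h 0)
  where
  lem : ∀ a b c → (a ℤ.* b ℤ.+ 0ℤ) ℤ.* c ℤ.+ 0ℤ ≡ a ℤ.* (b ℤ.* c ℤ.+ 0ℤ) ℤ.+ 0ℤ
  lem = ℤ-Ring.solve-∀
*ˢ-assoc f g h (suc n) = begin
  ((f *ˢ g) *ˢ h) (suc n)
    ≡⟨ *ˢ-coeff-suc (f *ˢ g) h n ⟩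
  (f *ˢ g) 0 ℤ.* h (suc n) ℤ.+ (((f *ˢ g) ∘ suc) *ˢ h) n
    ≡⟨ cong₂ ℤ._+_ (cong (ℤ._* h (suc n)) (*ˢ-coeff-zero f g))
         (trans (*ˢ-congʳ h (*ˢ-coeff-suc f g) n)
                (*ˢ-distribʳ (λ m → f 0 ℤ.* g (suc m)) ((f ∘ suc) *ˢ g) h n)) ⟩
  f 0 ℤ.* g 0 ℤ.* h (suc n) ℤ.+ (((λ m → f 0 ℤ.* g (suc m)) *ˢ h) n ℤ.+ (((f ∘ suc) *ˢ g) *ˢ h) n)
    ≡⟨ cong (λ z → f 0 ℤ.* g 0 ℤ.* h (suc n) ℤ.+ z)
         (cong₂ ℤ._+_ (*ˢ-scaleˡ (f 0) (g ∘ suc) h n) (*ˢ-assoc (f ∘ suc) g h n)) ⟩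
  f 0 ℤ.* g 0 ℤ.* h (suc n) ℤ.+ (f 0 ℤ.* ((g ∘ suc) *ˢ h) n ℤ.+ ((f ∘ suc) *ˢ (g *ˢ h)) n)
    ≡⟨ lem (f 0) (g 0) (h (suc n)) _ _ ⟩
  f 0 ℤ.* (g 0 ℤ.* h (suc n) ℤ.+ ((g ∘ suc) *ˢ h) n) ℤ.+ ((f ∘ suc) *ˢ (g *ˢ h)) n
    ≡⟨ cong (λ z → f 0 ℤ.* z ℤ.+ ((f ∘ suc) *ˢ (g *ˢ h)) n) (*ˢ-coeff-suc g h n) ⟨
  f 0 ℤ.* (g *ˢ h) (suc n) ℤ.+ ((f ∘ suc) *ˢ (g *ˢ h)) n
    ≡⟨ *ˢ-coeff-suc f (g *ˢ h) n ⟨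
  (f *ˢ (g *ˢ h)) (suc n) ∎
  where
  open ≡-Reasoning
  lem : ∀ a b c d e → a ℤ.* b ℤ.* c ℤ.+ (a ℤ.* d ℤ.+ e) ≡ a ℤ.* (b ℤ.* c ℤ.+ d) ℤ.+ e
  lem = ℤ-Ring.solve-∀

≈-refl : ∀ {f} → f ≈ f
≈-refl _ = refl

≈-sym : ∀ {f g} → f ≈ g → g ≈ f
≈-sym p n = sym (p n)

≈-trans : ∀ {f g h} → f ≈ g → g ≈ h → f ≈ h
≈-trans p r n = trans (p n) (r n)

*ˢ-commutativeMonoid : CommutativeMonoid 0ℓ 0ℓ
*ˢ-commutativeMonoid = record
  { Carrier = PowerSeries
  ; _≈_ = _≈_
  ; _∙_ = _*ˢ_
  ; ε = 1ˢ
  ; isCommutativeMonoid = record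
    { isMonoid = record
      { isSemigroup = record
        { isMagma = record
          { isEquivalence = record { refl = ≈-refl ; sym = ≈-sym ; trans = ≈-trans }
          ; ∙-cong = *ˢ-cong
          }
        ; assoc = *ˢ-assoc
        }
      ; identity = *ˢ-identityˡ , λ f → ≈-trans (*ˢ-comm f 1ˢ) (*ˢ-identityˡ f)
      }
    ; comm = *ˢ-comm
    }
  }

module *ˢ = CommutativeMonoid *ˢ-commutativeMonoid
module *ˢₚ = CommutativeSemigroupProperties *ˢ.commutativeSemigroup
module ≈-Reasoning = SetoidReasoning *ˢ.setoid

-- Multiplication by a power of q as a shift of coefficients

infixr 6.5 _▷_

-- Defined by recursion instead of as `q^ e *ˢ g`, so that the coefficients below `e` vanish by
-- computation and shifts compose without ring laws.
_▷_ : ℕ → PowerSeries → PowerSeries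
(zero  ▷ g) n       = g n
(suc e ▷ g) zero    = 0ℤ
(suc e ▷ g) (suc n) = (e ▷ g) n

▷-cong : ∀ e {g h} → g ≈ h → e ▷ g ≈ e ▷ h
▷-cong zero    p n       = p n
▷-cong (suc e) p zero    = refl
▷-cong (suc e) p (suc n) = ▷-cong e p n

▷-▷ : ∀ e e′ g → e ▷ (e′ ▷ g) ≈ (e + e′) ▷ g
▷-▷ zero    e′ g n       = refl
▷-▷ (suc e) e′ g zero    = refl
▷-▷ (suc e) e′ g (suc n) = ▷-▷ e e′ g n

▷-+ˢ : ∀ e g h → e ▷ (g +ˢ h) ≈ e ▷ g +ˢ e ▷ h
▷-+ˢ zero    g h n       = refl
▷-+ˢ (suc e) g h zero    = refl
▷-+ˢ (suc e) g h (suc n) = ▷-+ˢ e g h n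

▷-below : ∀ e g {n} → n < e → (e ▷ g) n ≡ 0ℤ
▷-below (suc e) g {zero}  _         = refl
▷-below (suc e) g {suc n} (s<s n<e) = ▷-below e g n<e

▷-above : ∀ e g n → (e ▷ g) (e + n) ≡ g n
▷-above zero    g n = refl
▷-above (suc e) g n = ▷-above e g n

q^≈▷1 : ∀ e → q^ e ≈ e ▷ 1ˢ
q^≈▷1 zero    n       = refl
q^≈▷1 (suc e) zero    = refl
q^≈▷1 (suc e) (suc n) = q^≈▷1 e n

q^*≈▷ : ∀ e g → q^ e *ˢ g ≈ e ▷ g
q^*≈▷ zero    g n       = *ˢ-identityˡ g n
q^*≈▷ (suc e) g zero    = refl
q^*≈▷ (suc e) g (suc n) =
  trans (*ˢ-coeff-suc (q^ suc e) g n) (trans (ℤₚ.+-identityˡ _) (q^*≈▷ e g n))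

[1+q^]*≈ : ∀ e g → (1ˢ +ˢ q^ e) *ˢ g ≈ g +ˢ e ▷ g
[1+q^]*≈ e g n = trans (*ˢ-distribʳ 1ˢ (q^ e) g n) (cong₂ ℤ._+_ (*ˢ-identityˡ g n) (q^*≈▷ e g n))

-- Locally finite sums

∑-cong : ∀ {I : Set} (xs : List I) {f g : I → ℤ} → (∀ x → f x ≡ g x) → ∑ xs f ≡ ∑ xs g
∑-cong []       p = refl
∑-cong (x ∷ xs) p = cong₂ ℤ._+_ (p x) (∑-cong xs p)

∑-zero : ∀ {I : Set} (xs : List I) {f : I → ℤ} → (∀ x → f x ≡ 0ℤ) → ∑ xs f ≡ 0ℤ
∑-zero []       p = refl
∑-zero (x ∷ xs) p = cong₂ ℤ._+_ (p x) (∑-zero xs p)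

∑-+ : ∀ {I : Set} (xs : List I) (f g : I → ℤ) →
      ∑ xs (λ x → f x ℤ.+ g x) ≡ ∑ xs f ℤ.+ ∑ xs g
∑-+ []       f g = refl
∑-+ (x ∷ xs) f g = trans (cong (λ z → f x ℤ.+ g x ℤ.+ z) (∑-+ xs f g)) (lem (f x) (g x) _ _)
  where
  lem : ∀ a b c d → a ℤ.+ b ℤ.+ (c ℤ.+ d) ≡ a ℤ.+ c ℤ.+ (b ℤ.+ d)
  lem = ℤ-Ring.solve-∀

∑-upTo-∷ʳ : ∀ n (h : ℕ → ℤ) → ∑ (upTo (suc n)) h ≡ ∑ (upTo n) h ℤ.+ h n
∑-upTo-∷ʳ zero    h = ℤₚ.+-comm (h 0) 0ℤ
∑-upTo-∷ʳ (suc n) h = begin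
  ∑ (upTo (suc (suc n))) h                        ≡⟨ ∑-upTo-suc (suc n) h ⟩
  h 0 ℤ.+ ∑ (upTo (suc n)) (h ∘ suc)              ≡⟨ cong (λ z → h 0 ℤ.+ z) (∑-upTo-∷ʳ n (h ∘ suc)) ⟩
  h 0 ℤ.+ (∑ (upTo n) (h ∘ suc) ℤ.+ h (suc n))    ≡⟨ ℤₚ.+-assoc (h 0) _ _ ⟨
  h 0 ℤ.+ ∑ (upTo n) (h ∘ suc) ℤ.+ h (suc n)      ≡⟨ cong (ℤ._+ h (suc n)) (∑-upTo-suc n h) ⟨
  ∑ (upTo (suc n)) h ℤ.+ h (suc n)                ∎
  where open ≡-Reasoning

∑-++ : ∀ {I : Set} (xs ys : List I) (f : I → ℤ) → ∑ (xs ++ ys) f ≡ ∑ xs f ℤ.+ ∑ ys f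
∑-++ []       ys f = sym (ℤₚ.+-identityˡ _)
∑-++ (x ∷ xs) ys f = trans (cong (λ z → f x ℤ.+ z) (∑-++ xs ys f)) (sym (ℤₚ.+-assoc (f x) _ _))

∑-map : ∀ {I J : Set} (e : I → J) (xs : List I) (f : J → ℤ) → ∑ (map e xs) f ≡ ∑ xs (f ∘ e)
∑-map e []       f = refl
∑-map e (x ∷ xs) f = cong (λ z → f (e x) ℤ.+ z) (∑-map e xs f)

∑-cartesianProduct : ∀ {I J : Set} (xs : List I) (ys : List J) (f : I × J → ℤ) →
  ∑ (cartesianProduct xs ys) f ≡ ∑ xs λ x → ∑ ys λ y → f (x , y)
∑-cartesianProduct []       ys f = refl
∑-cartesianProduct (x ∷ xs) ys f = trans (∑-++ (map (x ,_) ys) (cartesianProduct xs ys) f)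
  (cong₂ ℤ._+_ (∑-map (x ,_) ys f) (∑-cartesianProduct xs ys f))

▷-zero : ∀ e {g} n → (∀ m → m ≤ n → g m ≡ 0ℤ) → (e ▷ g) n ≡ 0ℤ
▷-zero zero    n       p = p n ℕₚ.≤-refl
▷-zero (suc e) zero    p = refl
▷-zero (suc e) (suc n) p = ▷-zero e n λ m m≤n → p m (ℕₚ.m≤n⇒m≤1+n m≤n)

-- The order is bounded by the index itself, so the cutoff for coefficient `n` is explicit: index
-- `n`.
LocallyFinite : (ℕ → PowerSeries) → Set
LocallyFinite u = ∀ a n → n < a → u a n ≡ 0ℤ

-- For locally finite u, this is the infinite sum of the u a.
opaque
  ⨁ : (ℕ → PowerSeries) → PowerSeries
  ⨁ u n = ∑ (upTo (suc n)) λ a → u a n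

  ⨁-cong : ∀ {u v} → (∀ a → u a ≈ v a) → ⨁ u ≈ ⨁ v
  ⨁-cong p n = ∑-cong (upTo (suc n)) λ a → p a n

  ⨁-head : ∀ {u} n → (∀ a → u (suc a) n ≡ 0ℤ) → ⨁ u n ≡ u 0 n
  ⨁-head {u} n p = begin
    ∑ (upTo (suc n)) (λ a → u a n)               ≡⟨ ∑-upTo-suc n (λ a → u a n) ⟩
    u 0 n ℤ.+ ∑ (upTo n) (λ a → u (suc a) n)     ≡⟨ cong (λ z → u 0 n ℤ.+ z) (∑-zero (upTo n) p) ⟩
    u 0 n ℤ.+ 0ℤ                                 ≡⟨ ℤₚ.+-identityʳ _ ⟩
    u 0 n                                        ∎
    where open ≡-Reasoning

  ⨁-coeff : ∀ u n → ⨁ u n ≡ ∑ (upTo (suc n)) λ a → u a n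
  ⨁-coeff u n = refl

  ⨁-zero : ∀ {u} n → (∀ a → u a n ≡ 0ℤ) → ⨁ u n ≡ 0ℤ
  ⨁-zero n p = ∑-zero (upTo (suc n)) p

  -- The two sides truncate at different indices, because a shift changes the degree at which `u` is
  -- read; local finiteness kills the surplus terms.
  ⨁-▷ : ∀ e {u} → LocallyFinite u → ⨁ (λ a → e ▷ u a) ≈ e ▷ ⨁ u
  ⨁-▷ zero    fin n       = refl
  ⨁-▷ (suc e) fin zero    = refl
  ⨁-▷ (suc e) {u} fin (suc n) = begin
    ∑ (upTo (suc (suc n))) (λ a → (e ▷ u a) n)
      ≡⟨ ∑-upTo-∷ʳ (suc n) (λ a → (e ▷ u a) n) ⟩
    ⨁ (λ a → e ▷ u a) n ℤ.+ (e ▷ u (suc n)) n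
      ≡⟨ cong₂ ℤ._+_ (⨁-▷ e fin n) (▷-zero e n λ m m≤n → fin (suc n) m (s≤s m≤n)) ⟩
    (e ▷ ⨁ u) n ℤ.+ 0ℤ
      ≡⟨ ℤₚ.+-identityʳ _ ⟩
    (e ▷ ⨁ u) n ∎
    where open ≡-Reasoning

  ⨁-lift : ∀ e {u v w} → LocallyFinite w → (∀ a → u a ≈ v a +ˢ e ▷ w a) → ⨁ u ≈ ⨁ v +ˢ e ▷ ⨁ w
  ⨁-lift e {u} {v} {w} fin p n = begin
    ⨁ u n                                         ≡⟨ ∑-cong (upTo (suc n)) (λ a → p a n) ⟩
    ∑ (upTo (suc n)) (λ a → v a n ℤ.+ (e ▷ w a) n) ≡⟨ ∑-+ (upTo (suc n)) (λ a → v a n) _ ⟩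
    ⨁ v n ℤ.+ ⨁ (λ a → e ▷ w a) n                 ≡⟨ cong (λ z → ⨁ v n ℤ.+ z) (⨁-▷ e fin n) ⟩
    ⨁ v n ℤ.+ (e ▷ ⨁ w) n                         ∎
    where open ≡-Reasoning

  -- Handles a q-difference equation at its own summation index, where cancelling a factor lowers
  -- the index by one. `⨁-lift` carries the result through the other indices.
  ⨁-step : ∀ {e u v w} → 0 < e → LocallyFinite w → u 0 ≈ v 0 →
           (∀ a → u (suc a) ≈ v (suc a) +ˢ e ▷ w a) → ⨁ u ≈ ⨁ v +ˢ e ▷ ⨁ w
  ⨁-step {suc e} {u} {v} {w} _ fin p₀ p n = begin
    ∑ (upTo (suc n)) (λ a → u a n)
      ≡⟨ ∑-upTo-suc n (λ a → u a n) ⟩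
    u 0 n ℤ.+ ∑ (upTo n) (λ a → u (suc a) n)
      ≡⟨ cong₂ ℤ._+_ (p₀ n) (trans (∑-cong (upTo n) (λ a → p a n)) (∑-+ (upTo n) (λ a → v (suc a) n) _)) ⟩
    v 0 n ℤ.+ (∑ (upTo n) (λ a → v (suc a) n) ℤ.+ ∑ (upTo n) (λ a → (suc e ▷ w a) n))
      ≡⟨ ℤₚ.+-assoc (v 0 n) _ _ ⟨
    v 0 n ℤ.+ ∑ (upTo n) (λ a → v (suc a) n) ℤ.+ ∑ (upTo n) (λ a → (suc e ▷ w a) n)
      ≡⟨ cong₂ ℤ._+_ (∑-upTo-suc n (λ a → v a n)) (trans (cong (λ z → shifted ℤ.+ z) (last n)) (ℤₚ.+-identityʳ shifted)) ⟨
    ⨁ v n ℤ.+ (shifted ℤ.+ (suc e ▷ w n) n)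
      ≡⟨ cong (λ z → ⨁ v n ℤ.+ z) (trans (sym (⨁-▷ (suc e) fin n)) (∑-upTo-∷ʳ n (λ a → (suc e ▷ w a) n))) ⟨
    ⨁ v n ℤ.+ (suc e ▷ ⨁ w) n ∎
    where
    open ≡-Reasoning
    shifted : ℤ
    shifted = ∑ (upTo n) (λ a → (suc e ▷ w a) n)
    -- Lowering the index loses the term at index `n`; it starts in degree at least `n`, and the
    -- positive shift pushes it further.
    last : ∀ n → (suc e ▷ w n) n ≡ 0ℤ
    last zero    = refl
    last (suc n) = ▷-zero e n λ m m≤n → fin (suc n) m (s≤s m≤n)

-- Reciprocals of q-Pochhammer symbols

recip-unique : ∀ f g → f 0 ≡ 1ℤ → f *ˢ g ≈ 1ˢ → g ≈ recip f
recip-unique f g f₀ fg = begin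
  g                      ≈⟨ *ˢ.identityˡ g ⟨
  1ˢ *ˢ g                ≈⟨ *ˢ-congʳ g (*ˢ-recip f f₀) ⟨
  (f *ˢ recip f) *ˢ g    ≈⟨ *ˢₚ.xy∙z≈xz∙y f (recip f) g ⟩
  (f *ˢ g) *ˢ recip f    ≈⟨ *ˢ-congʳ (recip f) fg ⟩
  1ˢ *ˢ recip f          ≈⟨ *ˢ.identityˡ (recip f) ⟩
  recip f                ∎
  where open ≈-Reasoning

-- Multiply 1 = (1 - q^e) + q^e by the reciprocal of `f′`. All four q-difference equations originate
-- here.
recip-step : ∀ e f f′ → f 0 ≡ 1ℤ → f′ 0 ≡ 1ℤ → f′ ≈ f *ˢ (1ˢ -ˢ q^ e) →
             recip f′ ≈ recip f +ˢ e ▷ recip f′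
recip-step e f f′ f₀ f′₀ p = begin
  recip f′                                              ≈⟨ *ˢ.identityˡ (recip f′) ⟨
  1ˢ *ˢ recip f′                                        ≈⟨ *ˢ-congʳ (recip f′) (λ n → lem (1ˢ n) ((q^ e) n)) ⟨
  ((1ˢ -ˢ q^ e) +ˢ q^ e) *ˢ recip f′                    ≈⟨ *ˢ-distribʳ (1ˢ -ˢ q^ e) (q^ e) (recip f′) ⟩
  (1ˢ -ˢ q^ e) *ˢ recip f′ +ˢ q^ e *ˢ recip f′          ≈⟨ (λ n → cong₂ ℤ._+_ (recip-unique f _ f₀ inverse n) (q^*≈▷ e (recip f′) n)) ⟩
  recip f +ˢ e ▷ recip f′                               ∎
  where
  open ≈-Reasoning
  lem : ∀ a b → a ℤ.- b ℤ.+ b ≡ a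
  lem = ℤ-Ring.solve-∀
  inverse : f *ˢ ((1ˢ -ˢ q^ e) *ˢ recip f′) ≈ 1ˢ
  inverse = begin
    f *ˢ ((1ˢ -ˢ q^ e) *ˢ recip f′)   ≈⟨ *ˢ-assoc f (1ˢ -ˢ q^ e) (recip f′) ⟨
    (f *ˢ (1ˢ -ˢ q^ e)) *ˢ recip f′   ≈⟨ *ˢ-congʳ (recip f′) p ⟨
    f′ *ˢ recip f′                    ≈⟨ *ˢ-recip f′ f′₀ ⟩
    1ˢ                                ∎

q^-*ˢ : ∀ d e → q^ d *ˢ q^ e ≈ q^ (d + e)
q^-*ˢ d e = begin
  q^ d *ˢ q^ e     ≈⟨ q^*≈▷ d (q^ e) ⟩
  d ▷ q^ e         ≈⟨ ▷-cong d (q^≈▷1 e) ⟩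
  d ▷ (e ▷ 1ˢ)     ≈⟨ ▷-▷ d e 1ˢ ⟩
  (d + e) ▷ 1ˢ     ≈⟨ q^≈▷1 (d + e) ⟨
  q^ (d + e)       ∎
  where open ≈-Reasoning

q^-^ˢ : ∀ e n → (q^ e) ^ˢ n ≈ q^ (e * n)
q^-^ˢ e zero    rewrite ℕₚ.*-zeroʳ e = ≈-refl
q^-^ˢ e (suc n) = begin
  (q^ e) ^ˢ n *ˢ q^ e   ≈⟨ *ˢ-congʳ (q^ e) (q^-^ˢ e n) ⟩
  q^ (e * n) *ˢ q^ e    ≈⟨ q^-*ˢ (e * n) e ⟩
  q^ (e * n + e)        ≡⟨ cong q^_ (trans (ℕₚ.+-comm (e * n) e) (sym (ℕₚ.*-suc e n))) ⟩
  q^ (e * suc n)        ∎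
  where open ≈-Reasoning

qPochhammer-suc : ∀ e n → qPochhammer (q^ e) (q^ e) (suc n) ≈
                          qPochhammer (q^ e) (q^ e) n *ˢ (1ˢ -ˢ q^ (e * suc n))
qPochhammer-suc e n = *ˢ-congˡ (qPochhammer (q^ e) (q^ e) n) λ m → cong (λ z → 1ˢ m ℤ.- z) (power m)
  where
  power : q^ e *ˢ (q^ e) ^ˢ n ≈ q^ (e * suc n)
  power = begin
    q^ e *ˢ (q^ e) ^ˢ n    ≈⟨ *ˢ-congˡ (q^ e) (q^-^ˢ e n) ⟩
    q^ e *ˢ q^ (e * n)     ≈⟨ q^-*ˢ e (e * n) ⟩
    q^ (e + e * n)         ≡⟨ cong q^_ (ℕₚ.*-suc e n) ⟨
    q^ (e * suc n)         ∎
    where open ≈-Reasoning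

module _ (p₁ p₂ p₃ p₄ x : PowerSeries) where

  open ≈-Reasoning

  factor₄ : p₁ *ˢ p₂ *ˢ p₃ *ˢ (p₄ *ˢ x) ≈ p₁ *ˢ p₂ *ˢ p₃ *ˢ p₄ *ˢ x
  factor₄ = ≈-sym (*ˢ-assoc (p₁ *ˢ p₂ *ˢ p₃) p₄ x)

  factor₃ : p₁ *ˢ p₂ *ˢ (p₃ *ˢ x) *ˢ p₄ ≈ p₁ *ˢ p₂ *ˢ p₃ *ˢ p₄ *ˢ x
  factor₃ = begin
    p₁ *ˢ p₂ *ˢ (p₃ *ˢ x) *ˢ p₄   ≈⟨ *ˢ-congʳ p₄ (*ˢ-assoc (p₁ *ˢ p₂) p₃ x) ⟨
    p₁ *ˢ p₂ *ˢ p₃ *ˢ x *ˢ p₄     ≈⟨ *ˢₚ.xy∙z≈xz∙y (p₁ *ˢ p₂ *ˢ p₃) x p₄ ⟩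
    p₁ *ˢ p₂ *ˢ p₃ *ˢ p₄ *ˢ x     ∎

  factor₂ : p₁ *ˢ (p₂ *ˢ x) *ˢ p₃ *ˢ p₄ ≈ p₁ *ˢ p₂ *ˢ p₃ *ˢ p₄ *ˢ x
  factor₂ = begin
    p₁ *ˢ (p₂ *ˢ x) *ˢ p₃ *ˢ p₄   ≈⟨ *ˢ-congʳ p₄ (*ˢ-congʳ p₃ (*ˢ-assoc p₁ p₂ x)) ⟨
    p₁ *ˢ p₂ *ˢ x *ˢ p₃ *ˢ p₄     ≈⟨ *ˢ-congʳ p₄ (*ˢₚ.xy∙z≈xz∙y (p₁ *ˢ p₂) x p₃) ⟩
    p₁ *ˢ p₂ *ˢ p₃ *ˢ x *ˢ p₄     ≈⟨ *ˢₚ.xy∙z≈xz∙y (p₁ *ˢ p₂ *ˢ p₃) x p₄ ⟩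
    p₁ *ˢ p₂ *ˢ p₃ *ˢ p₄ *ˢ x     ∎

  factor₁ : (p₁ *ˢ x) *ˢ p₂ *ˢ p₃ *ˢ p₄ ≈ p₁ *ˢ p₂ *ˢ p₃ *ˢ p₄ *ˢ x
  factor₁ = begin
    p₁ *ˢ x *ˢ p₂ *ˢ p₃ *ˢ p₄     ≈⟨ *ˢ-congʳ p₄ (*ˢ-congʳ p₃ (*ˢₚ.xy∙z≈xz∙y p₁ x p₂)) ⟩
    p₁ *ˢ p₂ *ˢ x *ˢ p₃ *ˢ p₄     ≈⟨ *ˢ-congʳ p₄ (*ˢₚ.xy∙z≈xz∙y (p₁ *ˢ p₂) x p₃) ⟩
    p₁ *ˢ p₂ *ˢ p₃ *ˢ x *ˢ p₄     ≈⟨ *ˢₚ.xy∙z≈xz∙y (p₁ *ˢ p₂ *ˢ p₃) x p₄ ⟩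
    p₁ *ˢ p₂ *ˢ p₃ *ˢ p₄ *ˢ x     ∎

-- The quadruple sum and its q-difference equations

triangle-suc : ∀ b → suc b * suc (suc b) / 2 ≡ b * suc b / 2 + suc b
triangle-suc b = begin
  suc b * suc (suc b) / 2          ≡⟨ cong (_/ 2) (lem b) ⟩
  (b * suc b + suc b * 2) / 2      ≡⟨ +-distrib-/-∣ʳ (b * suc b) (n∣m*n (suc b)) ⟩
  b * suc b / 2 + suc b * 2 / 2    ≡⟨ cong (λ z → b * suc b / 2 + z) (m*n/n≡m (suc b) 2) ⟩
  b * suc b / 2 + suc b            ∎
  where
  open ≡-Reasoning
  lem : ∀ b → suc b * suc (suc b) ≡ b * suc b + suc b * 2
  lem = ℕ-Ring.solve-∀

-- Writing t = τ + 1 turns the difference into a sum, which the ring solver can treat once `c` is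
-- split into cases.
tcc∸c : ∀ τ c → suc τ * c * c ∸ c ≡ τ * c * c + c * (c ∸ 1)
tcc∸c τ zero    = lem τ
  where
  lem : ∀ τ → suc τ * 0 * 0 ≡ τ * 0 * 0 + 0
  lem = ℕ-Ring.solve-∀
tcc∸c τ (suc c) = trans (cong (_∸ suc c) (lem τ c)) (ℕₚ.m+n∸n≡m (τ * suc c * suc c + suc c * c) (suc c))
  where
  lem : ∀ τ c → suc τ * suc c * suc c ≡ τ * suc c * suc c + suc c * c + suc c
  lem = ℕ-Ring.solve-∀

tcc∸c-suc : ∀ τ c → suc τ * suc c * suc c ∸ suc c ≡ (suc τ * c * c ∸ c) + (2 * suc τ * c + τ)
tcc∸c-suc τ zero = trans (tcc∸c τ 1) (trans (lem τ) (cong (_+ (2 * suc τ * 0 + τ)) (sym (tcc∸c τ 0))))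
  where
  lem : ∀ τ → τ * 1 * 1 + 0 ≡ τ * 0 * 0 + 0 + (2 * suc τ * 0 + τ)
  lem = ℕ-Ring.solve-∀
tcc∸c-suc τ (suc c) = trans (tcc∸c τ (2 + c)) (trans (lem τ c) (cong (_+ (2 * suc τ * suc c + τ)) (sym (tcc∸c τ (suc c)))))
  where
  lem : ∀ τ c → τ * suc (suc c) * suc (suc c) + suc (suc c) * suc c ≡ τ * suc c * suc c + suc c * c + (2 * suc τ * suc c + τ)
  lem = ℕ-Ring.solve-∀

weight : (t i j k l a b c d : ℕ) → ℕ
weight t i j k l a b c d = exponent t a b c d + t * (i * a + j * b + k * c + l * d)

module _ (t i j k l a b c d : ℕ) where

  weight-i : weight t i j k l a b c d + 2 * t * a ≡ weight t (2 + i) j k l a b c d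
  weight-i = lem (exponent t a b c d) t i j k l a b c d
    where
    lem : ∀ e t i j k l a b c d →
      e + t * (i * a + j * b + k * c + l * d) + 2 * t * a ≡ e + t * ((2 + i) * a + j * b + k * c + l * d)
    lem = ℕ-Ring.solve-∀

  weight-j : weight t i j k l a b c d + t * b ≡ weight t i (suc j) k l a b c d
  weight-j = lem (exponent t a b c d) t i j k l a b c d
    where
    lem : ∀ e t i j k l a b c d →
      e + t * (i * a + j * b + k * c + l * d) + t * b ≡ e + t * (i * a + suc j * b + k * c + l * d)
    lem = ℕ-Ring.solve-∀

  weight-k : weight t i j k l a b c d + t * c ≡ weight t i j (suc k) l a b c d
  weight-k = lem (exponent t a b c d) t i j k l a b c d
    where
    lem : ∀ e t i j k l a b c d →
      e + t * (i * a + j * b + k * c + l * d) + t * c ≡ e + t * (i * a + j * b + suc k * c + l * d)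
    lem = ℕ-Ring.solve-∀

  weight-l : weight t i j k l a b c d + t * d ≡ weight t i j k (suc l) a b c d
  weight-l = lem (exponent t a b c d) t i j k l a b c d
    where
    lem : ∀ e t i j k l a b c d →
      e + t * (i * a + j * b + k * c + l * d) + t * d ≡ e + t * (i * a + j * b + k * c + suc l * d)
    lem = ℕ-Ring.solve-∀

  -- The increments (4, 2, 2, 2) are the row of `a` in the matrix of second derivatives of Q_t / t;
  -- the rows (2, 1, 1, 1), (2, 1, 2, 1) and (2, 1, 1, 2) of `b`, `c` and `d` appear in the
  -- companion lemmas. The constant is the weight of the unit vector.
  weight-suc-a :
    weight t i j k l (suc a) b c d ≡ t * (2 + i) + weight t (4 + i) (2 + j) (2 + k) (2 + l) a b c d
  weight-suc-a = lem t i j k l a b c d (b * suc b / 2) (t * c * c ∸ c)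
    where
    -- `x` and `y` abstract the halved product and the truncated difference, neither of which is a
    -- ring expression.
    lem : ∀ t i j k l a b c d x y →
      2 * t * suc a * suc a + t * x + y + (t * d * d + d) + 2 * t * suc a * b + 2 * t * suc a * c + 2 * t * suc a * d
        + t * b * c + t * b * d + t * c * d + t * (i * suc a + j * b + k * c + l * d)
      ≡ t * (2 + i) + (2 * t * a * a + t * x + y + (t * d * d + d) + 2 * t * a * b + 2 * t * a * c + 2 * t * a * d
        + t * b * c + t * b * d + t * c * d + t * ((4 + i) * a + (2 + j) * b + (2 + k) * c + (2 + l) * d))
    lem = ℕ-Ring.solve-∀

  weight-suc-b :
    weight t i j k l a (suc b) c d ≡ t * suc j + weight t (2 + i) (suc j) (suc k) (suc l) a b c d
  weight-suc-b rewrite triangle-suc b = lem t i j k l a b c d (b * suc b / 2) (t * c * c ∸ c)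
    where
    lem : ∀ t i j k l a b c d x y →
      2 * t * a * a + t * (x + suc b) + y + (t * d * d + d) + 2 * t * a * suc b + 2 * t * a * c + 2 * t * a * d
        + t * suc b * c + t * suc b * d + t * c * d + t * (i * a + j * suc b + k * c + l * d)
      ≡ t * suc j + (2 * t * a * a + t * x + y + (t * d * d + d) + 2 * t * a * b + 2 * t * a * c + 2 * t * a * d
        + t * b * c + t * b * d + t * c * d + t * ((2 + i) * a + suc j * b + suc k * c + suc l * d))
    lem = ℕ-Ring.solve-∀

  weight-suc-d :
    weight t i j k l a b c (suc d) ≡ suc (t * suc l) + weight t (2 + i) (suc j) (suc k) (2 + l) a b c d
  weight-suc-d = lem t i j k l a b c d (b * suc b / 2) (t * c * c ∸ c)
    where
    lem : ∀ t i j k l a b c d x y →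
      2 * t * a * a + t * x + y + (t * suc d * suc d + suc d) + 2 * t * a * b + 2 * t * a * c + 2 * t * a * suc d
        + t * b * c + t * b * suc d + t * c * suc d + t * (i * a + j * b + k * c + l * suc d)
      ≡ suc (t * suc l) + (2 * t * a * a + t * x + y + (t * d * d + d) + 2 * t * a * b + 2 * t * a * c + 2 * t * a * d
        + t * b * c + t * b * d + t * c * d + t * ((2 + i) * a + suc j * b + suc k * c + (2 + l) * d))
    lem = ℕ-Ring.solve-∀

-- Stated for t = τ + 1 because the constant is t (k + 1) - 1.
weight-suc-c : ∀ τ i j k l a b c d →
  weight (suc τ) i j k l a b (suc c) d ≡ (suc τ * k + τ) + weight (suc τ) (2 + i) (suc j) (2 + k) (suc l) a b c d
weight-suc-c τ i j k l a b c d =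
  trans (cong (λ p → rest + suc τ * (b * suc b / 2) + p + (suc τ * d * d + d) + 2 * suc τ * a * b + 2 * suc τ * a * suc c
                       + 2 * suc τ * a * d + suc τ * b * suc c + suc τ * b * d + suc τ * suc c * d
                       + suc τ * (i * a + j * b + k * suc c + l * d)) (tcc∸c-suc τ c))
        (lem τ i j k l a b c d (b * suc b / 2) (suc τ * c * c ∸ c))
  where
  rest = 2 * suc τ * a * a
  lem : ∀ τ i j k l a b c d x y →
    2 * suc τ * a * a + suc τ * x + (y + (2 * suc τ * c + τ)) + (suc τ * d * d + d) + 2 * suc τ * a * b + 2 * suc τ * a * suc c
      + 2 * suc τ * a * d + suc τ * b * suc c + suc τ * b * d + suc τ * suc c * d
      + suc τ * (i * a + j * b + k * suc c + l * d)
    ≡ (suc τ * k + τ) + (2 * suc τ * a * a + suc τ * x + y + (suc τ * d * d + d) + 2 * suc τ * a * b + 2 * suc τ * a * c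
      + 2 * suc τ * a * d + suc τ * b * c + suc τ * b * d + suc τ * c * d
      + suc τ * ((2 + i) * a + suc j * b + (2 + k) * c + suc l * d))
  lem = ℕ-Ring.solve-∀

module SumSide (τ : ℕ) (0<τ : 0 < τ) where

  t : ℕ
  t = suc τ

  -- The parts of the partitions are μ i = (i + 1) t - 1, 1 + μ i and 2 + μ i.
  μ : ℕ → ℕ
  μ i = t * i + τ

  term : (i j k l a b c d : ℕ) → PowerSeries
  term i j k l a b c d = weight t i j k l a b c d ▷ recip (denominator t a b c d)

  -- Here 1 - q^h is the cancelled factor. `w + h ≡ w₁` says that q^h raises the matching parameter;
  -- `w ≡ e + w₂` says that lowering the summation index costs q^e and shifts all parameters.
  term-step : ∀ {r r′ w w₁ w₂} e h → r′ ≈ r +ˢ h ▷ r′ → w + h ≡ w₁ → w ≡ e + w₂ →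
              w ▷ r′ ≈ w₁ ▷ r′ +ˢ e ▷ (w₂ ▷ r)
  term-step {r} {r′} {w₂ = w₂} e h p refl refl n = begin
    ((e + w₂) ▷ r′) n                             ≡⟨ ▷-cong (e + w₂) p n ⟩
    ((e + w₂) ▷ (r +ˢ h ▷ r′)) n                  ≡⟨ ▷-+ˢ (e + w₂) r (h ▷ r′) n ⟩
    ((e + w₂) ▷ r) n ℤ.+ ((e + w₂) ▷ (h ▷ r′)) n  ≡⟨ ℤₚ.+-comm (((e + w₂) ▷ r) n) _ ⟩
    ((e + w₂) ▷ (h ▷ r′)) n ℤ.+ ((e + w₂) ▷ r) n  ≡⟨ cong₂ ℤ._+_ (▷-▷ (e + w₂) h r′ n) (sym (▷-▷ e w₂ r n)) ⟩
    ((e + w₂ + h) ▷ r′) n ℤ.+ (e ▷ (w₂ ▷ r)) n    ∎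
    where open ≡-Reasoning

  module _ (a b c d : ℕ) where

    recip-a : recip (denominator t (suc a) b c d) ≈
              recip (denominator t a b c d) +ˢ 2 * t * suc a ▷ recip (denominator t (suc a) b c d)
    recip-a = recip-step (2 * t * suc a) (denominator t a b c d) (denominator t (suc a) b c d)
      (denominator-constant a b c d z<s) (denominator-constant (suc a) b c d z<s)
      (≈-trans (*ˢ-congʳ pd (*ˢ-congʳ pc (*ˢ-congʳ pb (qPochhammer-suc (2 * t) a)))) (factor₁ (qPochhammer (q^ (2 * t)) (q^ (2 * t)) a) pb pc pd (1ˢ -ˢ q^ (2 * t * suc a))))
      where
      pb = qPochhammer (q^ t) (q^ t) b
      pc = qPochhammer (q^ t) (q^ t) c
      pd = qPochhammer (q^ t) (q^ t) d

    recip-b : recip (denominator t a (suc b) c d) ≈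
              recip (denominator t a b c d) +ˢ t * suc b ▷ recip (denominator t a (suc b) c d)
    recip-b = recip-step (t * suc b) (denominator t a b c d) (denominator t a (suc b) c d)
      (denominator-constant a b c d z<s) (denominator-constant a (suc b) c d z<s)
      (≈-trans (*ˢ-congʳ pd (*ˢ-congʳ pc (*ˢ-congˡ pa (qPochhammer-suc t b)))) (factor₂ pa (qPochhammer (q^ t) (q^ t) b) pc pd (1ˢ -ˢ q^ (t * suc b))))
      where
      pa = qPochhammer (q^ (2 * t)) (q^ (2 * t)) a
      pc = qPochhammer (q^ t) (q^ t) c
      pd = qPochhammer (q^ t) (q^ t) d

    recip-c : recip (denominator t a b (suc c) d) ≈
              recip (denominator t a b c d) +ˢ t * suc c ▷ recip (denominator t a b (suc c) d)
    recip-c = recip-step (t * suc c) (denominator t a b c d) (denominator t a b (suc c) d)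
      (denominator-constant a b c d z<s) (denominator-constant a b (suc c) d z<s)
      (≈-trans (*ˢ-congʳ pd (*ˢ-congˡ (pa *ˢ pb) (qPochhammer-suc t c))) (factor₃ pa pb (qPochhammer (q^ t) (q^ t) c) pd (1ˢ -ˢ q^ (t * suc c))))
      where
      pa = qPochhammer (q^ (2 * t)) (q^ (2 * t)) a
      pb = qPochhammer (q^ t) (q^ t) b
      pd = qPochhammer (q^ t) (q^ t) d

    recip-d : recip (denominator t a b c (suc d)) ≈
              recip (denominator t a b c d) +ˢ t * suc d ▷ recip (denominator t a b c (suc d))
    recip-d = recip-step (t * suc d) (denominator t a b c d) (denominator t a b c (suc d))
      (denominator-constant a b c d z<s) (denominator-constant a b c (suc d) z<s)
      (≈-trans (*ˢ-congˡ (pa *ˢ pb *ˢ pc) (qPochhammer-suc t d)) (factor₄ pa pb pc (qPochhammer (q^ t) (q^ t) d) (1ˢ -ˢ q^ (t * suc d))))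
      where
      pa = qPochhammer (q^ (2 * t)) (q^ (2 * t)) a
      pb = qPochhammer (q^ t) (q^ t) b
      pc = qPochhammer (q^ t) (q^ t) c

  weight-suc-b′ : ∀ i j k l a b c d →
    weight t i j k l a (suc b) c d ≡ suc (μ j) + weight t (2 + i) (suc j) (suc k) (suc l) a b c d
  weight-suc-b′ i j k l a b c d = trans (weight-suc-b t i j k l a b c d)
    (cong (_+ weight t (2 + i) (suc j) (suc k) (suc l) a b c d) (lem τ j))
    where
    lem : ∀ τ j → suc τ * suc j ≡ suc (suc τ * j + τ)
    lem = ℕ-Ring.solve-∀

  weight-suc-d′ : ∀ i j k l a b c d →
    weight t i j k l a b c (suc d) ≡ 2 + μ l + weight t (2 + i) (suc j) (suc k) (2 + l) a b c d
  weight-suc-d′ i j k l a b c d = trans (weight-suc-d t i j k l a b c d)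
    (cong (_+ weight t (2 + i) (suc j) (suc k) (2 + l) a b c d) (lem τ l))
    where
    lem : ∀ τ l → suc (suc τ * suc l) ≡ 2 + (suc τ * l + τ)
    lem = ℕ-Ring.solve-∀

  i<t[2+i] : ∀ i → i < t * (2 + i)
  i<t[2+i] i = ℕₚ.≤-trans (ℕₚ.n≤1+n (suc i)) (ℕₚ.m≤n*m (2 + i) t)

  i<μ : ∀ i → i < μ i
  i<μ i = ℕₚ.≤-trans (ℕₚ.≤-reflexive (ℕₚ.+-comm 1 i)) (ℕₚ.+-mono-≤ (ℕₚ.m≤n*m i t) 0<τ)

  suc-≤-+ : ∀ {m n e w} → m < e → n ≤ w → suc n ≤ e + w
  suc-≤-+ m<e n≤w = ℕₚ.+-mono-≤ (ℕₚ.≤-trans (s≤s z≤n) m<e) n≤w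

  -- By `weight-suc-a` each unit of `a` adds at least 1. The four bounds of this kind give local
  -- finiteness of the nested sums and confine the terms that reach q^n to a box.
  a≤weight : ∀ i j k l a b c d → a ≤ weight t i j k l a b c d
  a≤weight i j k l zero    b c d = z≤n
  a≤weight i j k l (suc a) b c d = ℕₚ.≤-trans
    (suc-≤-+ (i<t[2+i] i) (a≤weight (4 + i) (2 + j) (2 + k) (2 + l) a b c d))
    (ℕₚ.≤-reflexive (sym (weight-suc-a t i j k l a b c d)))

  b≤weight : ∀ i j k l a b c d → b ≤ weight t i j k l a b c d
  b≤weight i j k l a zero    c d = z≤n
  b≤weight i j k l a (suc b) c d = ℕₚ.≤-trans
    (s≤s (ℕₚ.≤-trans (b≤weight (2 + i) (suc j) (suc k) (suc l) a b c d) (ℕₚ.m≤n+m _ (μ j))))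
    (ℕₚ.≤-reflexive (sym (weight-suc-b′ i j k l a b c d)))

  c≤weight : ∀ i j k l a b c d → c ≤ weight t i j k l a b c d
  c≤weight i j k l a b zero    d = z≤n
  c≤weight i j k l a b (suc c) d = ℕₚ.≤-trans
    (suc-≤-+ (i<μ k) (c≤weight (2 + i) (suc j) (2 + k) (suc l) a b c d))
    (ℕₚ.≤-reflexive (sym (weight-suc-c τ i j k l a b c d)))

  d≤weight : ∀ i j k l a b c d → d ≤ weight t i j k l a b c d
  d≤weight i j k l a b c zero    = z≤n
  d≤weight i j k l a b c (suc d) = ℕₚ.≤-trans
    (s≤s (ℕₚ.≤-trans (d≤weight (2 + i) (suc j) (suc k) (2 + l) a b c d) (ℕₚ.m≤n+m _ (suc (μ l)))))
    (ℕₚ.≤-reflexive (sym (weight-suc-d′ i j k l a b c d)))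

  ⨁d : (i j k l a b c : ℕ) → PowerSeries
  ⨁d i j k l a b c = ⨁ (term i j k l a b c)

  ⨁cd : (i j k l a b : ℕ) → PowerSeries
  ⨁cd i j k l a b = ⨁ (⨁d i j k l a b)

  ⨁bcd : (i j k l a : ℕ) → PowerSeries
  ⨁bcd i j k l a = ⨁ (⨁cd i j k l a)

  f : (i j k l : ℕ) → PowerSeries
  f i j k l = ⨁ (⨁bcd i j k l)

  module _ (i j k l : ℕ) where

    term-below : ∀ a b c d {n} → n < weight t i j k l a b c d → term i j k l a b c d n ≡ 0ℤ
    term-below a b c d n<w = ▷-below (weight t i j k l a b c d) _ n<w

    finite-d : ∀ a b c → LocallyFinite (term i j k l a b c)
    finite-d a b c d n n<d = term-below a b c d (ℕₚ.≤-trans n<d (d≤weight i j k l a b c d))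

    finite-c : ∀ a b → LocallyFinite (⨁d i j k l a b)
    finite-c a b c n n<c = ⨁-zero n λ d → term-below a b c d (ℕₚ.≤-trans n<c (c≤weight i j k l a b c d))

    finite-b : ∀ a → LocallyFinite (⨁cd i j k l a)
    finite-b a b n n<b = ⨁-zero n λ c → ⨁-zero n λ d →
      term-below a b c d (ℕₚ.≤-trans n<b (b≤weight i j k l a b c d))

    finite-a : LocallyFinite (⨁bcd i j k l)
    finite-a a n n<a = ⨁-zero n λ b → ⨁-zero n λ c → ⨁-zero n λ d →
      term-below a b c d (ℕₚ.≤-trans n<a (a≤weight i j k l a b c d))

  -- At index 0 there is no factor to cancel, and raising the matching parameter changes nothing.
  term-0 : ∀ {w w₁} t (r : PowerSeries) → w + t * 0 ≡ w₁ → w ▷ r ≈ w₁ ▷ r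
  term-0 {w} t r refl n rewrite ℕₚ.*-zeroʳ t | ℕₚ.+-identityʳ w = refl

  module _ (i j k l : ℕ) where

    -- In this and the next three equations `⨁-step` stands at the nesting depth of the index that
    -- is lowered and `⨁-lift` at the other three.
    f-a : f i j k l ≈ f (2 + i) j k l +ˢ t * (2 + i) ▷ f (4 + i) (2 + j) (2 + k) (2 + l)
    f-a = ⨁-step (ℕₚ.≤-trans (s≤s z≤n) (i<t[2+i] i)) (finite-a (4 + i) (2 + j) (2 + k) (2 + l))
      (⨁-cong λ b → ⨁-cong λ c → ⨁-cong λ d → term-0 (2 * t) _ (weight-i t i j k l 0 b c d))
      λ a → ⨁-lift e (finite-b (4 + i) (2 + j) (2 + k) (2 + l) a) λ b → ⨁-lift e (finite-c (4 + i) (2 + j) (2 + k) (2 + l) a b) λ c →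
        ⨁-lift e (finite-d (4 + i) (2 + j) (2 + k) (2 + l) a b c) λ d →
        term-step e (2 * t * suc a) (recip-a a b c d) (weight-i t i j k l (suc a) b c d) (weight-suc-a t i j k l a b c d)
      where e = t * (2 + i)

    f-b : f i j k l ≈ f i (suc j) k l +ˢ suc (μ j) ▷ f (2 + i) (suc j) (suc k) (suc l)
    f-b = ⨁-lift e (finite-a (2 + i) (suc j) (suc k) (suc l)) λ a →
      ⨁-step z<s (finite-b (2 + i) (suc j) (suc k) (suc l) a)
      (⨁-cong λ c → ⨁-cong λ d → term-0 t _ (weight-j t i j k l a 0 c d))
      λ b → ⨁-lift e (finite-c (2 + i) (suc j) (suc k) (suc l) a b) λ c → ⨁-lift e (finite-d (2 + i) (suc j) (suc k) (suc l) a b c) λ d →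
        term-step e (t * suc b) (recip-b a b c d) (weight-j t i j k l a (suc b) c d) (weight-suc-b′ i j k l a b c d)
      where e = suc (μ j)

    f-c : f i j k l ≈ f i j (suc k) l +ˢ μ k ▷ f (2 + i) (suc j) (2 + k) (suc l)
    f-c = ⨁-lift e (finite-a (2 + i) (suc j) (2 + k) (suc l)) λ a → ⨁-lift e (finite-b (2 + i) (suc j) (2 + k) (suc l) a) λ b →
      ⨁-step (ℕₚ.≤-trans (s≤s z≤n) (i<μ k)) (finite-c (2 + i) (suc j) (2 + k) (suc l) a b)
      (⨁-cong λ d → term-0 t _ (weight-k t i j k l a b 0 d))
      λ c → ⨁-lift e (finite-d (2 + i) (suc j) (2 + k) (suc l) a b c) λ d →
        term-step e (t * suc c) (recip-c a b c d) (weight-k t i j k l a b (suc c) d) (weight-suc-c τ i j k l a b c d)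
      where e = μ k

    f-d : f i j k l ≈ f i j k (suc l) +ˢ (2 + μ l) ▷ f (2 + i) (suc j) (suc k) (2 + l)
    f-d = ⨁-lift e (finite-a (2 + i) (suc j) (suc k) (2 + l)) λ a → ⨁-lift e (finite-b (2 + i) (suc j) (suc k) (2 + l) a) λ b →
      ⨁-lift e (finite-c (2 + i) (suc j) (suc k) (2 + l) a b) λ c →
      ⨁-step z<s (finite-d (2 + i) (suc j) (suc k) (2 + l) a b c)
      (term-0 t _ (weight-l t i j k l a b c 0))
      λ d →
        term-step e (t * suc d) (recip-d a b c d) (weight-l t i j k l a b c (suc d)) (weight-suc-d′ i j k l a b c d)
      where e = 2 + μ l

  term-0000 : ∀ i j k l → term i j k l 0 0 0 0 ≈ 1ˢ
  term-0000 i j k l n = trans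
    (cong (λ w → (w ▷ recip (denominator t 0 0 0 0)) n) (lem τ i j k l))
    (sym (recip-unique (denominator t 0 0 0 0) 1ˢ refl denominator≈1 n))
    where
    lem : ∀ τ i j k l →
      2 * suc τ * 0 * 0 + suc τ * 0 + suc τ * 0 * 0 + (suc τ * 0 * 0 + 0) + 2 * suc τ * 0 * 0
        + 2 * suc τ * 0 * 0 + 2 * suc τ * 0 * 0 + suc τ * 0 * 0 + suc τ * 0 * 0 + suc τ * 0 * 0
        + suc τ * (i * 0 + j * 0 + k * 0 + l * 0) ≡ 0
    lem = ℕ-Ring.solve-∀
    denominator≈1 : 1ˢ *ˢ 1ˢ *ˢ 1ˢ *ˢ 1ˢ *ˢ 1ˢ ≈ 1ˢ
    denominator≈1 = ≈-trans (*ˢ.identityʳ (1ˢ *ˢ 1ˢ *ˢ 1ˢ *ˢ 1ˢ)) (≈-trans (*ˢ.identityʳ (1ˢ *ˢ 1ˢ *ˢ 1ˢ))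
      (≈-trans (*ˢ.identityʳ (1ˢ *ˢ 1ˢ)) (*ˢ.identityʳ 1ˢ)))

  -- A positive index costs a power of q beyond degree `n`, so only the term with all indices 0
  -- survives.
  f-limit : ∀ {i j k l n} → n < i → n < j → n < k → n < l → f i j k l n ≡ 1ˢ n
  f-limit {i} {j} {k} {l} {n} n<i n<j n<k n<l = begin
    f i j k l n
      ≡⟨ ⨁-head n (λ a → ⨁-zero n λ b → ⨁-zero n λ c → ⨁-zero n λ d → term-below i j k l (suc a) b c d
           (vanish (weight-suc-a t i j k l a b c d) (ℕₚ.<-trans n<i (i<t[2+i] i)))) ⟩
    ⨁bcd i j k l 0 n
      ≡⟨ ⨁-head n (λ b → ⨁-zero n λ c → ⨁-zero n λ d → term-below i j k l 0 (suc b) c d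
           (vanish (weight-suc-b′ i j k l 0 b c d) (ℕₚ.m<n⇒m<1+n (ℕₚ.<-trans n<j (i<μ j))))) ⟩
    ⨁cd i j k l 0 0 n
      ≡⟨ ⨁-head n (λ c → ⨁-zero n λ d → term-below i j k l 0 0 (suc c) d
           (vanish (weight-suc-c τ i j k l 0 0 c d) (ℕₚ.<-trans n<k (i<μ k)))) ⟩
    ⨁d i j k l 0 0 0 n
      ≡⟨ ⨁-head n (λ d → term-below i j k l 0 0 0 (suc d)
           (vanish (weight-suc-d′ i j k l 0 0 0 d) (ℕₚ.m<n⇒m<1+n (ℕₚ.m<n⇒m<1+n (ℕₚ.<-trans n<l (i<μ l)))))) ⟩
    term i j k l 0 0 0 0 n
      ≡⟨ term-0000 i j k l n ⟩
    1ˢ n ∎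
    where
    open ≡-Reasoning
    vanish : ∀ {w e v} → w ≡ e + v → n < e → n < w
    vanish refl n<e = ℕₚ.≤-trans n<e (ℕₚ.m≤m+n _ _)

  summand≈term : ∀ a b c d → summand t (a , b , c , d) ≈ term 0 0 0 0 a b c d
  summand≈term a b c d n = trans (q^*≈▷ (exponent t a b c d) (recip (denominator t a b c d)) n)
    (cong (λ w → (w ▷ recip (denominator t a b c d)) n)
      (sym (trans (cong (λ z → exponent t a b c d + z) (ℕₚ.*-zeroʳ t)) (ℕₚ.+-identityʳ _))))

  box : ℕ → List (ℕ × ℕ × ℕ × ℕ)
  box n = cartesianProduct r (cartesianProduct r (cartesianProduct r r))
    where r = upTo (suc n)

  box-unique : ∀ n → Unique (box n)
  box-unique n = Uniqueₚ.cartesianProduct⁺ r (Uniqueₚ.cartesianProduct⁺ r (Uniqueₚ.cartesianProduct⁺ r r))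
    where r = Uniqueₚ.upTo⁺ (suc n)

  -- The truncations of the four nested `⨁` at degree `n` run over exactly this box.
  ∑-box : ∀ n → ∑ (box n) (λ i → summand t i n) ≡ f 0 0 0 0 n
  ∑-box n = begin
    ∑ (box n) (λ i → summand t i n)
      ≡⟨ ∑-cong (box n) (λ (a , b , c , d) → summand≈term a b c d n) ⟩
    ∑ (box n) (λ (a , b , c , d) → T a b c d)
      ≡⟨ ∑-cartesianProduct r r³ (λ (a , b , c , d) → T a b c d) ⟩
    ∑ r (λ a → ∑ r³ λ (b , c , d) → T a b c d)
      ≡⟨ ∑-cong r (λ a → trans (∑-cartesianProduct r r² (λ (b , c , d) → T a b c d)) (∑-cong r λ b →
           trans (∑-cartesianProduct r r (λ (c , d) → T a b c d)) (∑-cong r λ c → sym (⨁-coeff (term 0 0 0 0 a b c) n)))) ⟩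
    ∑ r (λ a → ∑ r λ b → ∑ r λ c → ⨁d 0 0 0 0 a b c n)
      ≡⟨ ∑-cong r (λ a → trans (∑-cong r λ b → sym (⨁-coeff (⨁d 0 0 0 0 a b) n)) (sym (⨁-coeff (⨁cd 0 0 0 0 a) n))) ⟩
    ∑ r (λ a → ⨁bcd 0 0 0 0 a n)
      ≡⟨ ⨁-coeff (⨁bcd 0 0 0 0) n ⟨
    f 0 0 0 0 n ∎
    where
    open ≡-Reasoning
    r = upTo (suc n)
    r² = cartesianProduct r r
    r³ = cartesianProduct r r²
    T : (a b c d : ℕ) → ℤ
    T a b c d = term 0 0 0 0 a b c d n

  hasSum : HasSum (summand t) (f 0 0 0 0)
  hasSum n = box n , box-unique n , outside , ∑-box n
    where
    outside : ∀ i → i ∉ box n → summand t i n ≡ 0ℤ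
    outside (a , b , c , d) i∉ = trans (summand≈term a b c d n) (term-below 0 0 0 0 a b c d (ℕₚ.≰⇒> λ w≤n →
      i∉ (∈-cartesianProduct⁺ (∈r (a≤weight 0 0 0 0 a b c d) w≤n)
         (∈-cartesianProduct⁺ (∈r (b≤weight 0 0 0 0 a b c d) w≤n)
         (∈-cartesianProduct⁺ (∈r (c≤weight 0 0 0 0 a b c d) w≤n) (∈r (d≤weight 0 0 0 0 a b c d) w≤n))))))
      where
      ∈r : ∀ {x w} → x ≤ w → w ≤ n → x ∈ upTo (suc n)
      ∈r x≤w w≤n = ∈-upTo⁺ (s≤s (ℕₚ.≤-trans x≤w w≤n))

-- Factorization of the sum

▷-expand : ∀ e e′ {g g₁ g₂} → g ≈ g₁ +ˢ e′ ▷ g₂ → e ▷ g ≈ e ▷ g₁ +ˢ (e + e′) ▷ g₂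
▷-expand e e′ {g} {g₁} {g₂} p n = trans (▷-cong e p n)
  (trans (▷-+ˢ e g₁ (e′ ▷ g₂) n) (cong (λ z → (e ▷ g₁) n ℤ.+ z) (▷-▷ e e′ g₂ n)))

▷-≡ : ∀ {e e′} g → e ≡ e′ → e ▷ g ≈ e′ ▷ g
▷-≡ g refl n = refl

-- The rules of SumSide with the roles of (c, k) and (d, l) abstracted, so that they can be exchanged.
module Factorization
  (t : ℕ) (g : (i j k l : ℕ) → PowerSeries) (α β : ℕ → ℕ)
  (β-suc : ∀ l → β (suc l) ≡ β l + t)
  (α+β : ∀ k l → β l + α k ≡ t * (2 + (k + l)))
  (g-a : ∀ i j k l → g i j k l ≈ g (2 + i) j k l +ˢ t * (2 + i) ▷ g (4 + i) (2 + j) (2 + k) (2 + l))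
  (g-b : ∀ i k l → g i 0 k l ≈ g i 1 k l +ˢ t ▷ g (2 + i) 1 (suc k) (suc l))
  (g-c : ∀ i j k l → g i j k l ≈ g i j (suc k) l +ˢ α k ▷ g (2 + i) (suc j) (2 + k) (suc l))
  (g-d : ∀ i j k l → g i j k l ≈ g i j k (suc l) +ˢ β l ▷ g (2 + i) (suc j) (suc k) (2 + l))
  where

  -- Expanding by `g-b`, `g-c` and `g-d` produces four terms. Two of them recombine through `g-a`,
  -- because the first parameter is k + l.
  contiguous : ∀ k l → let m = k + l in
    g m 0 k l ≈ g m 1 (suc k) l +ˢ t ▷ g m 1 (suc k) (suc l) +ˢ α k ▷ g (2 + m) 2 (2 + k) (2 + l)
  contiguous k l n = begin
    g m 0 k l n
      ≡⟨ g-b m k l n ⟩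
    g m 1 k l n ℤ.+ s
      ≡⟨ cong (ℤ._+ s) (g-c m 1 k l n) ⟩
    p ℤ.+ (α k ▷ g (2 + m) 2 (2 + k) (suc l)) n ℤ.+ s
      ≡⟨ cong (λ z → p ℤ.+ z ℤ.+ s) (▷-expand (α k) (β (suc l)) (g-d (2 + m) 2 (2 + k) (suc l)) n) ⟩
    p ℤ.+ (r ℤ.+ ((α k + β (suc l)) ▷ g (4 + m) 3 (3 + k) (3 + l)) n) ℤ.+ s
      ≡⟨ cong (λ z → p ℤ.+ (r ℤ.+ z) ℤ.+ s) (▷-≡ (g (4 + m) 3 (3 + k) (3 + l)) shift n) ⟩
    p ℤ.+ (r ℤ.+ z) ℤ.+ s
      ≡⟨ lem p r z s ⟩
    p ℤ.+ (s ℤ.+ z) ℤ.+ r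
      ≡⟨ cong (λ z → p ℤ.+ z ℤ.+ r) (▷-expand t (t * (2 + m)) (g-a m 1 (suc k) (suc l)) n) ⟨
    p ℤ.+ (t ▷ g m 1 (suc k) (suc l)) n ℤ.+ r ∎
    where
    open ≡-Reasoning
    m = k + l
    p = g m 1 (suc k) l n
    r = (α k ▷ g (2 + m) 2 (2 + k) (2 + l)) n
    s = (t ▷ g (2 + m) 1 (suc k) (suc l)) n
    z = ((t + t * (2 + m)) ▷ g (4 + m) 3 (3 + k) (3 + l)) n
    lem : ∀ p r z s → p ℤ.+ (r ℤ.+ z) ℤ.+ s ≡ p ℤ.+ (s ℤ.+ z) ℤ.+ r
    lem = ℤ-Ring.solve-∀
    -- The left side is the cost of one `c` and then one `d`, the right side that of one `b` and
    -- then one `a`.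
    shift : α k + β (suc l) ≡ t + t * (2 + m)
    shift = begin
      α k + β (suc l)       ≡⟨ cong (λ b → α k + b) (β-suc l) ⟩
      α k + (β l + t)       ≡⟨ lem′ (α k) (β l) t ⟩
      t + (β l + α k)       ≡⟨ cong (λ b → t + b) (α+β k l) ⟩
      t + t * (2 + m)       ∎
      where
      lem′ : ∀ a b t → a + (b + t) ≡ t + (b + a)
      lem′ = ℕ-Ring.solve-∀

  -- Two uses of `g-d` and one of `g-a` lead to `g (2 + i) 0 k (2 + l)` plus three corrections.
  -- These are `β l` applied to the three terms of `contiguous` at k and l + 2.
  factor : ∀ k l {i} → i ≡ k + l → g i 0 k l ≈ g (2 + i) 0 k (2 + l) +ˢ β l ▷ g (2 + i) 0 k (2 + l)
  factor k l refl n = begin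
    g i 0 k l n
      ≡⟨ g-d i 0 k l n ⟩
    g i 0 k (suc l) n ℤ.+ x₁
      ≡⟨ cong (ℤ._+ x₁) (g-d i 0 k (suc l) n) ⟩
    g i 0 k (2 + l) n ℤ.+ (β (suc l) ▷ g (2 + i) 1 (suc k) (3 + l)) n ℤ.+ x₁
      ≡⟨ cong₂ (λ y z → y ℤ.+ z ℤ.+ x₁) (g-a i 0 k (2 + l) n) (▷-≡ (g (2 + i) 1 (suc k) (3 + l)) (β-suc l) n) ⟩
    h n ℤ.+ (t * (2 + i) ▷ g (4 + i) 2 (2 + k) (4 + l)) n ℤ.+ x₂ ℤ.+ x₁
      ≡⟨ cong (λ z → h n ℤ.+ z ℤ.+ x₂ ℤ.+ x₁) (▷-≡ (g (4 + i) 2 (2 + k) (4 + l)) (sym (α+β k l)) n) ⟩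
    h n ℤ.+ x₃ ℤ.+ x₂ ℤ.+ x₁
      ≡⟨ lem (h n) x₁ x₂ x₃ ⟩
    h n ℤ.+ (x₁ ℤ.+ x₂ ℤ.+ x₃)
      ≡⟨ cong (λ z → h n ℤ.+ z) expand ⟨
    h n ℤ.+ (β l ▷ h) n ∎
    where
    open ≡-Reasoning
    i = k + l
    h = g (2 + i) 0 k (2 + l)
    h₁ = g (2 + i) 1 (suc k) (2 + l)
    h₂ = g (2 + i) 1 (suc k) (3 + l)
    h₃ = g (4 + i) 2 (2 + k) (4 + l)
    x₁ = (β l ▷ h₁) n
    x₂ = ((β l + t) ▷ h₂) n
    x₃ = ((β l + α k) ▷ h₃) n
    lem : ∀ h x y z → h ℤ.+ z ℤ.+ y ℤ.+ x ≡ h ℤ.+ (x ℤ.+ y ℤ.+ z)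
    lem = ℤ-Ring.solve-∀
    contiguous′ : h ≈ h₁ +ˢ t ▷ h₂ +ˢ α k ▷ h₃
    contiguous′ = subst (λ m → g m 0 k (2 + l) ≈ g m 1 (suc k) (2 + l) +ˢ t ▷ g m 1 (suc k) (3 + l)
                                 +ˢ α k ▷ g (2 + m) 2 (2 + k) (4 + l))
      (ℕ+2 k l) (contiguous k (2 + l))
      where
      ℕ+2 : ∀ k l → k + (2 + l) ≡ 2 + (k + l)
      ℕ+2 = ℕ-Ring.solve-∀
    expand : (β l ▷ h) n ≡ x₁ ℤ.+ x₂ ℤ.+ x₃
    expand = trans (▷-expand (β l) (α k) {g₁ = h₁ +ˢ t ▷ h₂} contiguous′ n)
      (cong (ℤ._+ x₃) (▷-expand (β l) t {g₁ = h₁} {g₂ = h₂} (λ _ → refl) n))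

-- Agreement of power series modulo a power of q

AgreeBelow : ℕ → PowerSeries → PowerSeries → Set
AgreeBelow N f g = ∀ n → n < N → f n ≡ g n

module _ {N : ℕ} where

  agree-trans : ∀ {f g h} → AgreeBelow N f g → AgreeBelow N g h → AgreeBelow N f h
  agree-trans p r n n<N = trans (p n n<N) (r n n<N)

  agree-sym : ∀ {f g} → AgreeBelow N f g → AgreeBelow N g f
  agree-sym p n n<N = sym (p n n<N)

  ≈⇒agree : ∀ {f g} → f ≈ g → AgreeBelow N f g
  ≈⇒agree p n _ = p n

  agree-*ˢ : ∀ f {g g′} → AgreeBelow N g g′ → AgreeBelow N (f *ˢ g) (f *ˢ g′)
  agree-*ˢ f p n n<N = *ˢ-local {f} {f} n (λ _ _ → refl) λ m m≤n → p m (ℕₚ.≤-<-trans m≤n n<N)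

  agree-▷ : ∀ e {g g′} → AgreeBelow N g g′ → AgreeBelow N (e ▷ g) (e ▷ g′)
  agree-▷ e {g} {g′} p n n<N = trans (sym (q^*≈▷ e g n)) (trans (agree-*ˢ (q^ e) p n n<N) (q^*≈▷ e g′ n))

  agree-+ˢ : ∀ {f f′ g g′} → AgreeBelow N f f′ → AgreeBelow N g g′ → AgreeBelow N (f +ˢ g) (f′ +ˢ g′)
  agree-+ˢ p r n n<N = cong₂ ℤ._+_ (p n n<N) (r n n<N)

  agree-drop : ∀ {f g h e} → f ≈ g +ˢ e ▷ h → N ≤ e → AgreeBelow N f g
  agree-drop {g = g} {h} {e} p N≤e n n<N = trans (p n)
    (trans (cong (λ z → g n ℤ.+ z) (▷-below e h (ℕₚ.≤-trans n<N N≤e))) (ℤₚ.+-identityʳ _))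

∏<-+ : ∀ m n f → ∏< (n + m) f ≈ ∏< m f *ˢ ∏< n (λ i → f (i + m))
∏<-+ m zero    f = ≈-sym (*ˢ.identityʳ (∏< m f))
∏<-+ m (suc n) f = begin
  ∏< (n + m) f *ˢ f (n + m)                               ≈⟨ *ˢ-congʳ (f (n + m)) (∏<-+ m n f) ⟩
  ∏< m f *ˢ ∏< n (λ i → f (i + m)) *ˢ f (n + m)           ≈⟨ *ˢ-assoc (∏< m f) (∏< n (λ i → f (i + m))) (f (n + m)) ⟩
  ∏< m f *ˢ (∏< n (λ i → f (i + m)) *ˢ f (n + m))         ∎
  where open ≈-Reasoning

∏<-trivial : ∀ n {f} → (∀ i → i < n → f i ≡ 1ˢ) → ∏< n f ≈ 1ˢ
∏<-trivial zero    p = ≈-refl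
∏<-trivial (suc n) {f} p = begin
  ∏< n f *ˢ f n   ≡⟨ cong (∏< n f *ˢ_) (p n ℕₚ.≤-refl) ⟩
  ∏< n f *ˢ 1ˢ    ≈⟨ *ˢ.identityʳ (∏< n f) ⟩
  ∏< n f          ≈⟨ ∏<-trivial n (λ i i<n → p i (ℕₚ.m<n⇒m<1+n i<n)) ⟩
  1ˢ              ∎
  where open ≈-Reasoning

module Product (τ : ℕ) (0<τ : 0 < τ) where

  open SumSide τ 0<τ

  α+β : ∀ k l → 2 + μ l + μ k ≡ t * (2 + (k + l))
  α+β = lem τ
    where
    lem : ∀ τ k l → 2 + (suc τ * l + τ) + (suc τ * k + τ) ≡ suc τ * (2 + (k + l))
    lem = ℕ-Ring.solve-∀

  μ-suc : ∀ i → μ (suc i) ≡ μ i + t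
  μ-suc = lem τ
    where
    lem : ∀ τ i → suc τ * suc i + τ ≡ suc τ * i + τ + suc τ
    lem = ℕ-Ring.solve-∀

  suc-μ-0 : suc (μ 0) ≡ t
  suc-μ-0 = cong suc (cong (_+ τ) (ℕₚ.*-zeroʳ t))

  f-b₀ : ∀ i k l → f i 0 k l ≈ f i 1 k l +ˢ t ▷ f (2 + i) 1 (suc k) (suc l)
  f-b₀ i k l n = trans (f-b i 0 k l n)
    (cong (λ z → f i 1 k l n ℤ.+ z) (▷-≡ (f (2 + i) 1 (suc k) (suc l)) suc-μ-0 n))

  factor-d : ∀ k l {i} → i ≡ k + l → f i 0 k l ≈ f (2 + i) 0 k (2 + l) +ˢ (2 + μ l) ▷ f (2 + i) 0 k (2 + l)
  factor-d = Factorization.factor t f μ (λ l → 2 + μ l) (λ l → cong (2 +_) (μ-suc l)) α+β f-a f-b₀ f-c f-d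

  -- The mirror image: with the last two parameters of `f` exchanged, `μ` becomes the `β` of the
  -- abstract rules and `2 + μ` the `α`.
  factor-c : ∀ k l {i} → i ≡ l + k → f i 0 k l ≈ f (2 + i) 0 (2 + k) l +ˢ μ k ▷ f (2 + i) 0 (2 + k) l
  factor-c k l = Factorization.factor t (λ i j k l → f i j l k) (λ l → 2 + μ l) μ μ-suc
    (λ l k → trans (lem (μ k) (μ l)) (trans (α+β k l) (cong (λ n → t * (2 + n)) (ℕₚ.+-comm k l))))
    (λ i j k l → f-a i j l k) (λ i k l → f-b₀ i l k) (λ i j k l → f-d i j l k) (λ i j k l → f-c i j l k) l k
    where
    lem : ∀ x y → x + (2 + y) ≡ 2 + y + x
    lem = ℕ-Ring.solve-∀

  -- Only even arguments of `μ` occur, since each round raises k and l by 2. The exponents are 2tn +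
  -- t - 1 and 2tn + t + 1, while `multipleFactor` supplies the residues 0 and t modulo 2t.
  pairFactor : ℕ → PowerSeries
  pairFactor n = (1ˢ +ˢ q^ μ (n * 2)) *ˢ (1ˢ +ˢ q^ (2 + μ (n * 2)))

  multipleFactor : ℕ → PowerSeries
  multipleFactor j = 1ˢ +ˢ q^ suc (μ j)

  -- One round is `factor-c` followed by `factor-d`; each adds 2 to the first parameter and to k or
  -- l, so the slice i = k + l is kept.
  f-pairs : ∀ N → f 0 0 0 0 ≈ ∏< N pairFactor *ˢ f (N * 4) 0 (N * 2) (N * 2)
  f-pairs zero    = ≈-sym (*ˢ-identityˡ (f 0 0 0 0))
  f-pairs (suc N) = begin
    f 0 0 0 0
      ≈⟨ f-pairs N ⟩
    P *ˢ f (N * 4) 0 k k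
      ≈⟨ *ˢ-congˡ P (≈-trans (factor-c k k (lem N)) (≈-sym ([1+q^]*≈ (μ k) (f (2 + N * 4) 0 (2 + k) k)))) ⟩
    P *ˢ ((1ˢ +ˢ q^ μ k) *ˢ f (2 + N * 4) 0 (2 + k) k)
      ≈⟨ *ˢ-congˡ P (*ˢ-congˡ (1ˢ +ˢ q^ μ k) (≈-trans (factor-d (2 + k) k (cong (2 +_) (lem N)))
           (≈-sym ([1+q^]*≈ (2 + μ k) h)))) ⟩
    P *ˢ ((1ˢ +ˢ q^ μ k) *ˢ ((1ˢ +ˢ q^ (2 + μ k)) *ˢ h))
      ≈⟨ *ˢ-congˡ P (*ˢ-assoc (1ˢ +ˢ q^ μ k) (1ˢ +ˢ q^ (2 + μ k)) h) ⟨
    P *ˢ (pairFactor N *ˢ h)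
      ≈⟨ *ˢ-assoc P (pairFactor N) h ⟨
    P *ˢ pairFactor N *ˢ h ∎
    where
    open ≈-Reasoning
    P = ∏< N pairFactor
    k = N * 2
    h = f (4 + N * 4) 0 (2 + k) (2 + k)
    lem : ∀ N → N * 4 ≡ N * 2 + N * 2
    lem = ℕ-Ring.solve-∀

  module _ {N i k l : ℕ} (N≤i : N ≤ i) (N≤k : N ≤ k) (N≤l : N ≤ l) where

    -- The substitute for i = k = l = ∞: the corrections in the equations for `a`, `c` and `d` start
    -- at degree `N` or later.
    f-stable : ∀ j → AgreeBelow N (f i j k l) (f (2 + i) j (suc k) (suc l))
    f-stable j =
      agree-trans {g = f (2 + i) j k l}
        (agree-drop {h = f (4 + i) (2 + j) (2 + k) (2 + l)} (f-a i j k l) (ℕₚ.≤-trans N≤i (ℕₚ.<⇒≤ (i<t[2+i] i))))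
      (agree-trans {g = f (2 + i) j (suc k) l}
        (agree-drop {h = f (4 + i) (suc j) (2 + k) (suc l)} (f-c (2 + i) j k l) (ℕₚ.≤-trans N≤k (ℕₚ.<⇒≤ (i<μ k))))
        (agree-drop {h = f (4 + i) (suc j) (2 + k) (2 + l)} (f-d (2 + i) j (suc k) l)
          (ℕₚ.≤-trans N≤l (ℕₚ.≤-trans (ℕₚ.<⇒≤ (i<μ l)) (ℕₚ.m≤n+m (μ l) 2)))))

    -- By `f-stable` both terms of `f-b` contain the same series modulo q^N, so each step splits off
    -- one factor.
    f-multiples : ∀ J → AgreeBelow N (f i 0 k l) (∏< J multipleFactor *ˢ f i J k l)
    f-multiples zero    = ≈⇒agree (≈-sym (*ˢ-identityˡ (f i 0 k l)))
    f-multiples (suc J) = agree-trans (f-multiples J) (agree-trans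
      (agree-*ˢ P (agree-trans (≈⇒agree (f-b i J k l))
        (agree-trans (agree-+ˢ {f = h} (λ _ _ → refl) (agree-▷ (suc (μ J)) (agree-sym (f-stable (suc J)))))
          (≈⇒agree (≈-sym ([1+q^]*≈ (suc (μ J)) h))))))
      (≈⇒agree (≈-sym (*ˢ-assoc P (multipleFactor J) h))))
      where
      P = ∏< J multipleFactor
      h = f i (suc J) k l

  f-product : ∀ N → AgreeBelow N (f 0 0 0 0) (∏< N pairFactor *ˢ ∏< (N * 2) multipleFactor)
  f-product N = agree-trans (≈⇒agree (f-pairs N)) (agree-*ˢ (∏< N pairFactor)
    -- Each of the N periods of length 2t contains two multiples of t, hence 2N factors beside N
    -- pairs.
    (agree-trans (f-multiples N≤4N N≤2N N≤2N (N * 2)) (agree-trans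
      (agree-*ˢ B λ n n<N → f-limit {N * 4} {N * 2} {N * 2} {N * 2} (ℕₚ.≤-trans n<N N≤4N)
        (ℕₚ.≤-trans n<N N≤2N) (ℕₚ.≤-trans n<N N≤2N) (ℕₚ.≤-trans n<N N≤2N))
      (≈⇒agree (*ˢ.identityʳ B)))))
    where
    B = ∏< (N * 2) multipleFactor
    N≤2N = ℕₚ.m≤m*n N 2
    N≤4N = ℕₚ.m≤m*n N 4

-- The infinite product

≅-intro : ∀ r k {m n} → n ≡ r + k * m → n ≅ ℤ.+ r [mod m ]
≅-intro r k {m} refl = subst (m ∣_) (sym distance) (n∣m*n k)
  where
  distance : ℤ.∣ ℤ.+ (r + k * m) ℤ.- ℤ.+ r ∣ ≡ k * m
  distance = trans (cong ℤ.∣_∣ (trans (ℤₚ.m-n≡m⊖n (r + k * m) r) (ℤₚ.⊖-≥ (ℕₚ.m≤m+n r (k * m)))))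
    (ℕₚ.m+n∸m≡n r (k * m))

-- The congruence is divisibility of an absolute value, hence the two cases; remainders make
-- distinct residues easy to tell apart.
≅-elim : ∀ {n r m} .{{_ : NonZero m}} → n ≅ ℤ.+ r [mod m ] → n % m ≡ r % m
≅-elim {n} {r} {m} n≅r with ℕₚ.≤-total r n | subst (m ∣_) (cong ℤ.∣_∣ (ℤₚ.m-n≡m⊖n n r)) n≅r
... | inj₁ r≤n | divides k eq = trans (cong (_% m) (begin
  n             ≡⟨ ℕₚ.m+[n∸m]≡n r≤n ⟨
  r + (n ∸ r)   ≡⟨ cong (λ d → r + d) (trans (cong ℤ.∣_∣ (sym (ℤₚ.⊖-≥ r≤n))) eq) ⟩
  r + k * m     ∎)) ([m+kn]%n≡m%n r k m)
  where open ≡-Reasoning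
... | inj₂ n≤r | divides k eq = sym (trans (cong (_% m) (begin
  r             ≡⟨ ℕₚ.m+[n∸m]≡n n≤r ⟨
  n + (r ∸ n)   ≡⟨ cong (λ d → n + d) (trans (cong ℤ.∣_∣ (sym (ℤₚ.⊖-≥ n≤r))) (trans (ℤₚ.∣m⊖n∣≡∣n⊖m∣ r n) eq)) ⟩
  n + k * m     ∎)) ([m+kn]%n≡m%n n k m))
  where open ≡-Reasoning

productFactor-hit : ∀ t n → ProductResidue t n → productFactor t n ≡ 1ˢ +ˢ q^ n
productFactor-hit t n p = cong (λ b → if b then 1ˢ +ˢ q^ n else 1ˢ) (dec-true (productResidue? t n) p)

productFactor-miss : ∀ t n → ¬ ProductResidue t n → productFactor t n ≡ 1ˢ
productFactor-miss t n p = cong (λ b → if b then 1ˢ +ˢ q^ n else 1ˢ) (dec-false (productResidue? t n) p)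

module ProductLimit (σ : ℕ) where

  τ : ℕ
  τ = suc σ

  open SumSide τ z<s
  open Product τ z<s

  T : ℕ
  T = 2 * t

  productResidue-% : ∀ {n} → ProductResidue t n → n % T ≡ 0 ⊎ n % T ≡ τ ⊎ n % T ≡ t ⊎ n % T ≡ t + 1
  productResidue-% {n} (inj₁ p)                      = inj₁ (≅-elim {n} {0} {T} p)
  productResidue-% {n} (inj₂ (inj₁ p))               = inj₂ (inj₁ (trans (≅-elim {n} {τ} {T} p) (m<n⇒m%n≡m (ℕₚ.m≤m+n t (t + 0)))))
  productResidue-% {n} (inj₂ (inj₂ (inj₁ p)))        = inj₂ (inj₂ (inj₁ (trans (≅-elim {n} {t} {T} p) (m<n⇒m%n≡m (ℕₚ.m<m+n t z<s)))))
  productResidue-% {n} (inj₂ (inj₂ (inj₂ p)))        = inj₂ (inj₂ (inj₂ (trans (≅-elim {n} {t + 1} {T} p) (m<n⇒m%n≡m (ℕₚ.+-monoʳ-< t (s<s z<s))))))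

  -- Index `i` belongs to the exponent i + 1, so every residue is one more than the remainder of its
  -- index.
  factorAt : ℕ → PowerSeries
  factorAt i = productFactor t (suc i)

  miss : ∀ N r → suc r < T → suc r ≢ τ → suc r ≢ t → suc r ≢ t + 1 → factorAt (r + N * T) ≡ 1ˢ
  miss N r r<T ≢τ ≢t ≢t+1 = productFactor-miss t (suc r + N * T) λ p → case (productResidue-% p)
    where
    rem : (suc r + N * T) % T ≡ suc r
    rem = trans ([m+kn]%n≡m%n (suc r) N T) (m<n⇒m%n≡m r<T)
    case : ¬ ((suc r + N * T) % T ≡ 0 ⊎ (suc r + N * T) % T ≡ τ ⊎ (suc r + N * T) % T ≡ t ⊎ (suc r + N * T) % T ≡ t + 1)
    case (inj₁ e)               = contradiction (trans (sym rem) e) λ ()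
    case (inj₂ (inj₁ e))        = ≢τ (trans (sym rem) e)
    case (inj₂ (inj₂ (inj₁ e))) = ≢t (trans (sym rem) e)
    case (inj₂ (inj₂ (inj₂ e))) = ≢t+1 (trans (sym rem) e)

  module _ (N : ℕ) where

    g : ℕ → PowerSeries
    g i = factorAt (i + N * T)

    k = N * 2

    part-τ : ∀ σ N → suc (σ + N * (2 * (2 + σ))) ≡ (2 + σ) * (N * 2) + suc σ
    part-τ = ℕ-Ring.solve-∀

    part-2t : ∀ σ N → suc (σ + (3 + σ) + N * (2 * (2 + σ))) ≡ suc ((2 + σ) * suc (N * 2) + suc σ)
    part-2t = ℕ-Ring.solve-∀

    last≡T : ∀ σ → suc (σ + (3 + σ)) ≡ 2 * (2 + σ)
    last≡T = ℕ-Ring.solve-∀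

    g-τ : g σ ≡ 1ˢ +ˢ q^ μ k
    g-τ = trans (productFactor-hit t (τ + N * T) (inj₂ (inj₁ (≅-intro τ N refl))))
      (cong (λ e → 1ˢ +ˢ q^ e) (part-τ σ N))

    g-t : g (1 + σ) ≡ 1ˢ +ˢ q^ suc (μ k)
    g-t = trans (productFactor-hit t (t + N * T) (inj₂ (inj₂ (inj₁ (≅-intro t N refl)))))
      (cong (λ e → 1ˢ +ˢ q^ suc e) (part-τ σ N))

    g-t+1 : g (2 + σ) ≡ 1ˢ +ˢ q^ (2 + μ k)
    g-t+1 = trans (productFactor-hit t (suc t + N * T) (inj₂ (inj₂ (inj₂ (≅-intro (t + 1) N (cong (_+ N * T) (ℕₚ.+-comm 1 t)))))))
      (cong (λ e → 1ˢ +ˢ q^ suc (suc e)) (part-τ σ N))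

    g-2t : g (σ + (3 + σ)) ≡ 1ˢ +ˢ q^ suc (μ (suc k))
    g-2t = trans (productFactor-hit t (suc (σ + (3 + σ)) + N * T) (inj₁ (≅-intro 0 (suc N) (cong (_+ N * T) (last≡T σ)))))
      (cong (λ e → 1ˢ +ˢ q^ e) (part-2t σ N))

    low-trivial : ∏< σ g ≈ 1ˢ
    low-trivial = ∏<-trivial σ λ i i<σ → miss N i
      (ℕₚ.≤-trans (s<s (ℕₚ.m<n⇒m<1+n i<σ)) (ℕₚ.m≤m+n t _))
      (ℕₚ.<⇒≢ (s<s i<σ)) (ℕₚ.<⇒≢ (s<s (ℕₚ.m<n⇒m<1+n i<σ)))
      (ℕₚ.<⇒≢ (s<s (ℕₚ.<-trans i<σ (ℕₚ.≤-trans (ℕₚ.n≤1+n (suc σ)) (ℕₚ.≤-reflexive (ℕₚ.+-comm 1 (suc σ)))))))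

    high-trivial : ∏< σ (λ i → g (i + (3 + σ))) ≈ 1ˢ
    high-trivial = ∏<-trivial σ λ i i<σ → miss N (i + (3 + σ))
      (ℕₚ.≤-trans (s≤s (ℕₚ.+-monoˡ-< (3 + σ) i<σ)) (ℕₚ.≤-reflexive (last≡T σ)))
      (big i (ℕₚ.m≤n+m (1 + σ) 2)) (big i (ℕₚ.m≤n+m (2 + σ) 1)) (big i (ℕₚ.≤-reflexive (ℕₚ.+-comm t 1)))
      where
      big : ∀ i {m} → m ≤ 3 + σ → suc (i + (3 + σ)) ≢ m
      big i m≤ = ℕₚ.>⇒≢ (s≤s (ℕₚ.≤-trans m≤ (ℕₚ.m≤n+m (3 + σ) i)))

    -- With σ = t - 2, a period splits as σ + 3 + σ + 1: trivial factors, the residues t - 1, t, t +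
    -- 1, trivial factors again, and finally 2t.
    block : ∏< T g ≈ pairFactor N *ˢ (multipleFactor k *ˢ multipleFactor (suc k))
    block = begin
      ∏< T g
        ≡⟨ cong (λ m → ∏< m g) (last≡T σ) ⟨
      ∏< (σ + (3 + σ)) g *ˢ g (σ + (3 + σ))
        ≈⟨ *ˢ-congʳ (g (σ + (3 + σ))) (≈-trans (∏<-+ (3 + σ) σ g) (*ˢ-congˡ (∏< (3 + σ) g) high-trivial)) ⟩
      (∏< σ g *ˢ g σ *ˢ g (1 + σ) *ˢ g (2 + σ)) *ˢ 1ˢ *ˢ g (σ + (3 + σ))
        ≡⟨ cong₂ (λ (x , y) (z , w) → (∏< σ g *ˢ x *ˢ y *ˢ z) *ˢ 1ˢ *ˢ w) (cong₂ _,_ g-τ g-t) (cong₂ _,_ g-t+1 g-2t) ⟩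
      (∏< σ g *ˢ x *ˢ y *ˢ z) *ˢ 1ˢ *ˢ w
        ≈⟨ *ˢ-congʳ w (*ˢ.identityʳ (∏< σ g *ˢ x *ˢ y *ˢ z)) ⟩
      ∏< σ g *ˢ x *ˢ y *ˢ z *ˢ w
        ≈⟨ *ˢ-congʳ w (*ˢ-congʳ z (*ˢ-congʳ y (≈-trans (*ˢ-congʳ x low-trivial) (*ˢ-identityˡ x)))) ⟩
      x *ˢ y *ˢ z *ˢ w
        ≈⟨ *ˢ-congʳ w (*ˢₚ.xy∙z≈xz∙y x y z) ⟩
      x *ˢ z *ˢ y *ˢ w
        ≈⟨ *ˢ-assoc (x *ˢ z) y w ⟩
      pairFactor N *ˢ (multipleFactor k *ˢ multipleFactor (suc k)) ∎
      where
      open ≈-Reasoning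
      x = 1ˢ +ˢ q^ μ k
      y = 1ˢ +ˢ q^ suc (μ k)
      z = 1ˢ +ˢ q^ (2 + μ k)
      w = 1ˢ +ˢ q^ suc (μ (suc k))

  blocks : ∀ N → ∏< (N * T) factorAt ≈ ∏< N pairFactor *ˢ ∏< (N * 2) multipleFactor
  blocks zero    = ≈-sym (*ˢ.identityʳ 1ˢ)
  blocks (suc N) = begin
    ∏< (T + N * T) factorAt
      ≈⟨ ∏<-+ (N * T) T factorAt ⟩
    ∏< (N * T) factorAt *ˢ ∏< T (g N)
      ≈⟨ *ˢ-cong (blocks N) (block N) ⟩
    (P *ˢ M) *ˢ (p *ˢ (m *ˢ m′))
      ≈⟨ *ˢ-assoc P M (p *ˢ (m *ˢ m′)) ⟩
    P *ˢ (M *ˢ (p *ˢ (m *ˢ m′)))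
      ≈⟨ *ˢ-congˡ P (*ˢₚ.x∙yz≈y∙xz M p (m *ˢ m′)) ⟩
    P *ˢ (p *ˢ (M *ˢ (m *ˢ m′)))
      ≈⟨ *ˢ-assoc P p (M *ˢ (m *ˢ m′)) ⟨
    P *ˢ p *ˢ (M *ˢ (m *ˢ m′))
      ≈⟨ *ˢ-congˡ (P *ˢ p) (*ˢ-assoc M m m′) ⟨
    P *ˢ p *ˢ (M *ˢ m *ˢ m′) ∎
    where
    open ≈-Reasoning
    P = ∏< N pairFactor
    M = ∏< (N * 2) multipleFactor
    p = pairFactor N
    m = multipleFactor (N * 2)
    m′ = multipleFactor (suc (N * 2))

  -- Serves twice: the shifted copy starts at degree m + 1, which gives convergence, and it counts
  -- the partitions with largest part m + 1.
  ∏<-hit : ∀ m → ProductResidue t (suc m) →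
           ∏< (suc m) factorAt ≈ ∏< m factorAt +ˢ suc m ▷ ∏< m factorAt
  ∏<-hit m p = begin
    ∏< m factorAt *ˢ factorAt m               ≡⟨ cong (∏< m factorAt *ˢ_) (productFactor-hit t (suc m) p) ⟩
    ∏< m factorAt *ˢ (1ˢ +ˢ q^ suc m)         ≈⟨ *ˢ-comm (∏< m factorAt) (1ˢ +ˢ q^ suc m) ⟩
    (1ˢ +ˢ q^ suc m) *ˢ ∏< m factorAt         ≈⟨ [1+q^]*≈ (suc m) (∏< m factorAt) ⟩
    ∏< m factorAt +ˢ suc m ▷ ∏< m factorAt    ∎
    where open ≈-Reasoning

  ∏<-miss : ∀ m → ¬ ProductResidue t (suc m) → ∏< (suc m) factorAt ≈ ∏< m factorAt
  ∏<-miss m p = begin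
    ∏< m factorAt *ˢ factorAt m               ≡⟨ cong (∏< m factorAt *ˢ_) (productFactor-miss t (suc m) p) ⟩
    ∏< m factorAt *ˢ 1ˢ                       ≈⟨ *ˢ.identityʳ (∏< m factorAt) ⟩
    ∏< m factorAt                             ∎
    where open ≈-Reasoning

  factorAt-agree : ∀ n m → AgreeBelow n (∏< (m + n) factorAt) (∏< n factorAt)
  factorAt-agree n zero    = λ _ _ → refl
  factorAt-agree n (suc m) = agree-trans (step (productResidue? t (suc (m + n)))) (factorAt-agree n m)
    where
    step : Dec (ProductResidue t (suc (m + n))) →
           AgreeBelow n (∏< (suc (m + n)) factorAt) (∏< (m + n) factorAt)
    step (yes p) = agree-drop {h = ∏< (m + n) factorAt} (∏<-hit (m + n) p)
      (ℕₚ.≤-trans (ℕₚ.m≤n+m n m) (ℕₚ.n≤1+n (m + n)))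
    step (no ¬p) = ≈⇒agree (∏<-miss (m + n) ¬p)

  hasProduct : HasProduct factorAt (f 0 0 0 0)
  hasProduct n = N , λ m m≥N → begin
    ∏< m factorAt n                ≡⟨ cong (λ m → ∏< m factorAt n) (ℕₚ.m∸n+n≡m m≥N) ⟨
    ∏< (m ∸ N + N) factorAt n      ≡⟨ factorAt-agree N (m ∸ N) n n<N ⟩
    ∏< N factorAt n                ≡⟨ blocks (suc n) n ⟩
    (∏< (suc n) pairFactor *ˢ ∏< (suc n * 2) multipleFactor) n
                                   ≡⟨ f-product (suc n) n ℕₚ.≤-refl ⟨
    f 0 0 0 0 n                    ∎
    where
    open ≡-Reasoning
    -- `f-product (suc n)` is valid below degree n + 1, hence at `n`; after its n + 1 periods no
    -- later factor reaches q^n.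
    N = suc n * T
    n<N : n < N
    n<N = ℕₚ.m≤m*n (suc n) T

-- Counting chains of parts

Counts : {A : Set} → (A → Set) → ℤ → Set
Counts P z = ∃[ p ] HasCardinality P p × z ≡ ℤ.+ p

module _ {A : Set} where

  counts-⇔ : {P Q : A → Set} {z : ℤ} → (∀ x → P x ⇔ Q x) → Counts P z → Counts Q z
  counts-⇔ P⇔Q (p , (xs , unique , ∈⇔ , len) , z≡) =
    p , (xs , unique , (λ x → mk⇔ (to (P⇔Q x) ∘ to (∈⇔ x)) (from (∈⇔ x) ∘ from (P⇔Q x))) , len) , z≡

  counts-≡ : {P : A → Set} {y z : ℤ} → y ≡ z → Counts P y → Counts P z
  counts-≡ refl c = c

  counts-∅ : {P : A → Set} → (∀ x → ¬ P x) → Counts P 0ℤ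
  counts-∅ ¬P = 0 , ([] , [] , (λ x → mk⇔ (λ ()) (λ p → contradiction p (¬P x))) , refl) , refl

  counts-singleton : {P : A → Set} (a : A) → (∀ x → x ≡ a ⇔ P x) → Counts P 1ℤ
  counts-singleton a ≡⇔P = counts-⇔ ≡⇔P
    (1 , (a ∷ [] , ([] ∷ []) , (λ x → mk⇔ (λ { (here e) → e ; (there ()) }) here) , refl) , refl)

  counts-⊎ : {P Q : A → Set} {y z : ℤ} → (∀ x → P x → ¬ Q x) →
             Counts P y → Counts Q z → Counts (λ x → P x ⊎ Q x) (y ℤ.+ z)
  counts-⊎ disjoint (p , (xs , uxs , ∈xs⇔ , refl) , refl) (r , (ys , uys , ∈ys⇔ , refl) , refl) =
    p + r
    , (xs ++ ys
      , Uniqueₚ.++⁺ uxs uys (λ (∈xs , ∈ys) → disjoint _ (to (∈xs⇔ _) ∈xs) (to (∈ys⇔ _) ∈ys))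
      , (λ x → mk⇔ ([ inj₁ ∘ to (∈xs⇔ x) , inj₂ ∘ to (∈ys⇔ x) ]′ ∘ ∈-++⁻ xs)
                   [ ∈-++⁺ˡ ∘ from (∈xs⇔ x) , ∈-++⁺ʳ xs ∘ from (∈ys⇔ x) ]′)
      , Listₚ.length-++ xs)
    , refl

  counts-map : {P : A → Set} {B : Set} {z : ℤ} (g : A → B) → (∀ {x y} → g x ≡ g y → x ≡ y) →
               Counts P z → Counts (λ y → ∃[ x ] y ≡ g x × P x) z
  counts-map g inj (p , (xs , unique , ∈⇔ , len) , z≡) =
    p
    , (map g xs
      , Uniqueₚ.map⁺ inj unique
      , (λ y → mk⇔ (λ y∈ → let (x , x∈ , y≡) = ∈-map⁻ g y∈ in x , y≡ , to (∈⇔ x) x∈)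
                   λ { (x , refl , px) → ∈-map⁺ g (from (∈⇔ x) px) })
      , trans (Listₚ.length-map g xs) len)
    , z≡

-- The bound `N` gives the recurrences by smallest part an end: they lead to ever larger parts, and
-- from parts of size `N` on only the empty list remains.
Enumerates : ℕ → (List ℕ → Set) → PowerSeries → Set
Enumerates N C g = ∀ n → n < N → Counts (λ ps → sum ps ≡ n × C ps) (g n)

module Chains (Part : ℕ → Set) (Next : ℕ → ℕ → Set) where

  -- `B` constrains the head alone, and the tail after `x` is again a chain, with head condition
  -- `Next x`. Thus one term of a recurrence corresponds to one prepended part.
  Chain : (ℕ → Set) → List ℕ → Set
  Chain B []       = ⊤
  Chain B (x ∷ ps) = B x × Part x × Chain (Next x) ps

  module _ {B B′ : ℕ → Set} (B⇔B′ : ∀ {x} → Part x → B x ⇔ B′ x) where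

    -- Head conditions matter on admissible parts only. This lets a separation rule be replaced by a
    -- threshold.
    chain-⇔ : ∀ ps → Chain B ps ⇔ Chain B′ ps
    chain-⇔ []       = mk⇔ id id
    chain-⇔ (x ∷ ps) = mk⇔ (λ (b , p , c) → to (B⇔B′ p) b , p , c) (λ (b , p , c) → from (B⇔B′ p) b , p , c)

    enum-⇔ : ∀ {N g} → Enumerates N (Chain B) g → Enumerates N (Chain B′) g
    enum-⇔ e n n<N = counts-⇔ (λ ps → mk⇔ (λ (s , c) → s , to (chain-⇔ ps) c) (λ (s , c) → s , from (chain-⇔ ps) c)) (e n n<N)

  enum-agree : ∀ {N C g h} → AgreeBelow N g h → Enumerates N C g → Enumerates N C h
  enum-agree p e n n<N = counts-≡ (p n n<N) (e n n<N)

  enum-empty : ∀ {N B} → (∀ {x} → Part x → B x → N ≤ x) → Enumerates N (Chain B) 1ˢ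
  enum-empty {N} {B} large zero n<N = counts-singleton [] λ ps → mk⇔ (λ { refl → refl , tt }) (only-[] ps)
    where
    only-[] : ∀ ps → sum ps ≡ 0 × Chain B ps → ps ≡ []
    only-[] []       _               = refl
    only-[] (x ∷ ps) (s , b , p , _) =
      contradiction (ℕₚ.≤-trans n<N (ℕₚ.≤-trans (large p b) (ℕₚ.≤-trans (ℕₚ.m≤m+n x _) (ℕₚ.≤-reflexive s)))) λ ()
  enum-empty {N} {B} large (suc n) n<N = counts-∅ none
    where
    none : ∀ ps → ¬ (sum ps ≡ suc n × Chain B ps)
    none []       ()
    none (x ∷ ps) (s , b , p , _) = ℕₚ.<⇒≱ n<N
      (ℕₚ.≤-trans (large p b) (ℕₚ.≤-trans (ℕₚ.m≤m+n x _) (ℕₚ.≤-reflexive s)))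

  enum-cons : ∀ {N C g} x → Enumerates N C g → Enumerates N (λ ps → ∃[ qs ] ps ≡ x ∷ qs × C qs) (x ▷ g)
  enum-cons {N} {C} {g} x e n n<N with x ℕₚ.≤? n
  ... | no x≰n = counts-≡ (sym (▷-below x g (ℕₚ.≰⇒> x≰n)))
    (counts-∅ λ { _ (s , qs , refl , _) → x≰n (ℕₚ.≤-trans (ℕₚ.m≤m+n x _) (ℕₚ.≤-reflexive s)) })
  ... | yes x≤n = subst (λ m → Counts (λ ps → sum ps ≡ m × ∃[ qs ] ps ≡ x ∷ qs × C qs) ((x ▷ g) m)) (ℕₚ.m+[n∸m]≡n x≤n)
    (counts-⇔ (λ ps → mk⇔ (λ { (qs , refl , s , c) → cong (x +_) s , qs , refl , c })
                          λ { (s , qs , refl , c) → qs , refl , ℕₚ.+-cancelˡ-≡ x _ _ s , c })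
      (counts-map (x ∷_) Listₚ.∷-injectiveʳ (counts-≡ (sym (▷-above x g (n ∸ x)))
        (e (n ∸ x) (ℕₚ.≤-<-trans (ℕₚ.m∸n≤m n x) n<N)))))

  -- The shape of every recurrence: `g` counts the chains that do not begin with `x`, and `x ▷ h`
  -- those that do.
  enum-part : ∀ {N B g h} x → Part x → ¬ B x → Enumerates N (Chain B) g → Enumerates N (Chain (Next x)) h →
              Enumerates N (Chain (λ y → y ≡ x ⊎ B y)) (g +ˢ x ▷ h)
  enum-part {B = B} x px ¬Bx eg eh n n<N = counts-⇔ split (counts-⊎ disjoint (eg n n<N) (enum-cons x eh n n<N))
    where
    disjoint : ∀ ps → sum ps ≡ n × Chain B ps → ¬ (sum ps ≡ n × ∃[ qs ] ps ≡ x ∷ qs × Chain (Next x) qs)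
    disjoint _ (_ , b , _) (_ , _ , refl , _) = ¬Bx b
    split : ∀ ps → (sum ps ≡ n × Chain B ps ⊎ sum ps ≡ n × ∃[ qs ] ps ≡ x ∷ qs × Chain (Next x) qs) ⇔
                   (sum ps ≡ n × Chain (λ y → y ≡ x ⊎ B y) ps)
    split []       = mk⇔ (λ { (inj₁ c) → c ; (inj₂ (_ , _ , () , _)) }) inj₁
    split (y ∷ ps) = mk⇔ (λ { (inj₁ (s , b , p , c)) → s , inj₂ b , p , c
                            ; (inj₂ (s , _ , refl , c)) → s , inj₁ refl , px , c })
                         λ { (s , inj₁ refl , p , c) → inj₂ (s , ps , refl , c)
                           ; (s , inj₂ b , p , c) → inj₁ (s , b , p , c) }

  chain-parts : ∀ {B} ps → Chain B ps → All Part ps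
  chain-parts []       _           = []
  chain-parts (x ∷ ps) (_ , p , c) = p ∷ chain-parts {Next x} ps c

  chain-all : ∀ {B} {Q : ℕ → Set} → (∀ {x} → B x → Q x) → (∀ {x y} → Q x → Next x y → Q y) →
              ∀ ps → Chain B ps → All Q ps
  chain-all B⇒Q Next⇒Q []       _           = []
  chain-all B⇒Q Next⇒Q (x ∷ ps) (b , _ , c) = q ∷ chain-all {Next x} (Next⇒Q q) Next⇒Q ps c
    where q = B⇒Q b

  chain-linked : ∀ {B} ps → Chain B ps → Linked Next ps
  chain-linked []           _                     = []
  chain-linked (x ∷ [])     _                     = [-]
  chain-linked (x ∷ y ∷ ps) (_ , _ , c@(n , _ , _)) = n ∷ chain-linked {Next x} (y ∷ ps) c

  chain-intro : ∀ {B} ps → All B ps → All Part ps → Linked Next ps → Chain B ps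
  chain-intro []       _       _        _ = tt
  chain-intro (x ∷ ps) (b ∷ _) (p ∷ as) l = b , p , tail ps as l
    where
    tail : ∀ {x} ps → All Part ps → Linked Next (x ∷ ps) → Chain (Next x) ps
    tail []       _        _       = tt
    tail (y ∷ ps) (p ∷ as) (n ∷ l) = n , p , tail ps as l

linked-reverse : ∀ {R : ℕ → ℕ → Set} {ps} → Linked R ps → Linked (flip R) (reverse ps)
linked-reverse {ps = []}     _ = []
linked-reverse {R} {x ∷ ps} l = onto ps l [-]
  where
  onto : ∀ {x qs} ps → Linked R (x ∷ ps) → Linked (flip R) (x ∷ qs) → Linked (flip R) ((x ∷ ps) ʳ++ qs)
  onto []       _       l′ = l′
  onto (y ∷ ps) (r ∷ l) l′ = onto ps l (r ∷ l′)

sum-reverse : ∀ ps → sum (reverse ps) ≡ sum ps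
sum-reverse ps = sum-↭ (↭-reverse ps)

all-reverse : ∀ {P : ℕ → Set} {ps} → All P ps → All P (reverse ps)
all-reverse {ps = ps} = All-resp-↭ (↭-sym (↭-reverse ps))

-- The two classes of partitions

sum-bound : ∀ ps → All (_≤ sum ps) ps
sum-bound []       = []
sum-bound (x ∷ ps) = ℕₚ.m≤m+n x (sum ps) ∷ All.map (λ y≤ → ℕₚ.≤-trans y≤ (ℕₚ.m≤n+m (sum ps) x)) (sum-bound ps)

linked-weaken : ∀ {P : ℕ → Set} {R S : ℕ → ℕ → Set} → (∀ {x y} → P x → P y → R x y → S x y) →
                ∀ {ps} → All P ps → Linked R ps → Linked S ps
linked-weaken imp _              []      = []
linked-weaken imp _              [-]     = [-]
linked-weaken imp (p ∷ r ∷ as) (x ∷ l) = imp p r x ∷ linked-weaken imp (r ∷ as) l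

-- Partitions with prescribed residues modulo 2t

module ProductPartitions (σ : ℕ) where

  open ProductLimit σ
  open SumSide τ z<s using (t; f)
  open Chains (ProductResidue t) (λ x y → 0 < y × y < x)

  UpTo : ℕ → ℕ → Set
  UpTo m y = 0 < y × y ≤ m

  -- Chains descend here: the last factor decides whether the largest part is `m`.
  enum-∏< : ∀ N m → Enumerates N (Chain (UpTo m)) (∏< m factorAt)
  enum-∏< N zero    = enum-empty λ _ (0<y , y≤0) → contradiction (ℕₚ.≤-trans 0<y y≤0) λ ()
  enum-∏< N (suc m) = go (productResidue? t (suc m))
    where
    go : Dec (ProductResidue t (suc m)) → Enumerates N (Chain (UpTo (suc m))) (∏< (suc m) factorAt)
    go (yes p) = enum-agree (≈⇒agree (≈-sym (∏<-hit m p)))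
      (enum-⇔ (λ _ → mk⇔ [ (λ { refl → z<s , ℕₚ.≤-refl }) , (λ (0<y , y≤m) → 0<y , ℕₚ.m≤n⇒m≤1+n y≤m) ]′ split)
        (enum-part (suc m) p (λ (_ , m<m) → ℕₚ.1+n≰n m<m) (enum-∏< N m)
          (enum-⇔ (λ _ → mk⇔ (λ (0<y , y≤m) → 0<y , s≤s y≤m) (λ { (0<y , s≤s y≤m) → 0<y , y≤m })) (enum-∏< N m))))
      where
      split : ∀ {y} → UpTo (suc m) y → y ≡ suc m ⊎ UpTo m y
      split {y} (0<y , y≤1+m) with ℕₚ.m≤n⇒m<n∨m≡n y≤1+m
      ... | inj₁ (s≤s y≤m) = inj₂ (0<y , y≤m)
      ... | inj₂ y≡1+m     = inj₁ y≡1+m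
    go (no ¬p) = enum-agree (≈⇒agree (≈-sym (∏<-miss m ¬p)))
      (enum-⇔ (λ py → mk⇔ (λ (0<y , y≤m) → 0<y , ℕₚ.m≤n⇒m≤1+n y≤m) (shrink py)) (enum-∏< N m))
      where
      shrink : ∀ {y} → ProductResidue t y → UpTo (suc m) y → UpTo m y
      shrink py (0<y , y≤1+m) with ℕₚ.m≤n⇒m<n∨m≡n y≤1+m
      ... | inj₁ (s≤s y≤m) = 0<y , y≤m
      ... | inj₂ refl      = contradiction py ¬p

  productGF : IsGeneratingFunction (ProductClass t) (f 0 0 0 0)
  -- At least `M`, so that the coefficient has settled, and at least `n`, so that no part of a
  -- partition of `n` is excluded.
  productGF n = counts-≡ (stable (n + M) (ℕₚ.m≤n+m M n))
    (counts-⇔ equivalence (enum-∏< (suc n) (n + M) n ℕₚ.≤-refl))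
    where
    M = proj₁ (hasProduct n)
    stable = proj₂ (hasProduct n)
    equivalence : ∀ ps → (sum ps ≡ n × Chain (UpTo (n + M)) ps) ⇔ (DistinctPartition n ps × ProductClass t ps)
    equivalence ps = mk⇔
      (λ (s , c) → (Linked.map proj₂ (chain-linked ps c) , chain-all proj₁ (λ _ → proj₁) ps c , s) , chain-parts ps c)
      (λ { ((l , pos , refl) , parts) → refl , chain-intro ps
             (All.zipWith (λ (0<y , y≤) → 0<y , ℕₚ.≤-trans y≤ (ℕₚ.m≤m+n (sum ps) M)) (pos , sum-bound ps))
             parts (linked-weaken (λ _ 0<y x>y → 0<y , x>y) pos l) })

-- Partitions with difference conditions

module SumPartitions (ρ : ℕ) where

  σ τ : ℕ
  σ = suc ρ
  τ = suc σ

  open SumSide τ z<s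
  open Product τ z<s using (μ-suc)

  T : ℕ
  T = 2 * t

  τ≤μ : ∀ i → τ ≤ μ i
  τ≤μ i = ℕₚ.m≤n+m τ (t * i)

  μ-mono : ∀ {i j} → i ≤ j → μ i ≤ μ j
  μ-mono i≤j = ℕₚ.+-monoˡ-≤ τ (ℕₚ.*-monoʳ-≤ t i≤j)

  μ-form : ∀ i → μ i ≡ τ + i * t
  μ-form i = trans (ℕₚ.+-comm (t * i) τ) (cong (λ z → τ + z) (ℕₚ.*-comm t i))

  suc-μ : ∀ i → suc (μ i) ≡ suc i * t
  suc-μ i = cong suc (μ-form i)

  part-μ : ∀ i → SumResidue t (μ i)
  part-μ i = inj₂ (inj₂ (divides (suc i) (trans (ℕₚ.+-comm (μ i) 1) (suc-μ i))))

  part-1+μ : ∀ i → SumResidue t (suc (μ i))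
  part-1+μ i = inj₁ (≅-intro 0 (suc i) (suc-μ i))

  part-2+μ : ∀ i → SumResidue t (2 + μ i)
  part-2+μ i = inj₂ (inj₁ (≅-intro 1 (suc i) (cong suc (suc-μ i))))

  -- `1 < n` discards 0 and 1, which lie at the multiple 0 of t and so below the first triple.
  part-form : ∀ {n} → 1 < n → SumResidue t n → ∃[ j ] ∃[ r ] r ≤ 2 × n ≡ r + μ j
  part-form {n} 1<n (inj₁ (divides q eq)) = at q (trans (sym (ℕₚ.+-identityʳ n)) eq)
    where
    at : ∀ q → n ≡ q * t → ∃[ j ] ∃[ r ] r ≤ 2 × n ≡ r + μ j
    at zero    refl = contradiction 1<n λ ()
    at (suc j) eq   = j , 1 , s≤s z≤n , trans eq (sym (suc-μ j))
  part-form {suc n} (s≤s 0<n) (inj₂ (inj₁ (divides q eq))) = at q eq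
    where
    at : ∀ q → n ≡ q * t → ∃[ j ] ∃[ r ] r ≤ 2 × suc n ≡ r + μ j
    at zero    refl = contradiction 0<n λ ()
    at (suc j) eq   = j , 2 , s≤s (s≤s z≤n) , cong suc (trans eq (sym (suc-μ j)))
  part-form {n} _ (inj₂ (inj₂ (divides q eq))) = at q (trans (ℕₚ.+-comm 1 n) eq)
    where
    at : ∀ q → suc n ≡ q * t → ∃[ j ] ∃[ r ] r ≤ 2 × n ≡ r + μ j
    at (suc j) eq = j , 0 , z≤n , ℕₚ.suc-injective (trans eq (sym (suc-μ j)))

  -- Chains ascend here, while `Separated` expects the larger part first.
  Next : ℕ → ℕ → Set
  Next x y = x < y × Separated t y x

  not-multiple : ∀ k {n} r → n ≡ suc r + k * t → suc r < t → ¬ (n ≅ 0ℤ [mod t ])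
  not-multiple k {n} r refl r<t n≅0 = contradiction
    (trans (sym (trans ([m+kn]%n≡m%n (suc r) k t) (m<n⇒m%n≡m r<t))) (≅-elim {n} {0} {t} n≅0)) λ ()

  μ-not-multiple : ∀ i → ¬ (μ i ≅ 0ℤ [mod t ])
  μ-not-multiple i = not-multiple i σ (μ-form i) ℕₚ.≤-refl

  2+μ-not-multiple : ∀ i → ¬ (2 + μ i ≅ 0ℤ [mod t ])
  2+μ-not-multiple i = not-multiple (suc i) 0 (cong suc (suc-μ i)) (s≤s (s≤s z≤n))

  -- Each hypothesis refutes one alternative: closeness the gap, the second the two multiples of t,
  -- and a nonzero remainder of the sum the last.
  not-separated : ∀ {x y} → y ≤ x + t → ¬ (y ≅ 0ℤ [mod t ] × x ≅ 0ℤ [mod t ]) →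
                  ∀ k s → y + x ≡ suc s + k * T → suc s < T → ¬ Separated t y x
  not-separated {x} {y} close _ _ _ _ _ (inj₁ far) = ℕₚ.1+n≰n {t} (begin
    suc t       ≡⟨ ℕₚ.+-comm 1 t ⟩
    t + 1       ≤⟨ far ⟩
    y ∸ x       ≤⟨ ℕₚ.∸-monoˡ-≤ x close ⟩
    x + t ∸ x   ≡⟨ ℕₚ.m+n∸m≡n x t ⟩
    t           ∎)
    where open ℕₚ.≤-Reasoning
  not-separated _ mult _ _ _ _ (inj₂ (inj₁ both)) = mult both
  not-separated {x} {y} _ _ k s eq s<T (inj₂ (inj₂ p)) = contradiction
    (trans (sym (trans (cong (_% T) eq) (trans ([m+kn]%n≡m%n (suc s) k T) (m<n⇒m%n≡m s<T)))) (≅-elim {y + x} {0} {T} p)) λ ()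

  next-far : ∀ {x y} → x + (t + 1) ≤ y → Next x y
  next-far {x} {y} far = ℕₚ.≤-trans (ℕₚ.m<m+n x z<s) far
    , inj₁ (ℕₚ.≤-trans (ℕₚ.≤-reflexive (sym (ℕₚ.m+n∸m≡n x (t + 1)))) (ℕₚ.∸-monoˡ-≤ x far))


  -- Three regions decide what may follow a part near (i + 1) t: the rest of its own triple, the
  -- next triple, and everything beyond.
  locate : ∀ {i y} → μ i < y → SumResidue t y →
           y ≡ 1 + μ i ⊎ y ≡ 2 + μ i ⊎ (∃[ r ] r ≤ 2 × y ≡ r + μ (suc i)) ⊎ μ (2 + i) ≤ y
  locate {i} {y} μi<y py = place (part-form (ℕₚ.≤-<-trans (s≤s z≤n) (ℕₚ.≤-<-trans (τ≤μ i) μi<y)) py)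
    where
    place : ∃[ j ] ∃[ r ] r ≤ 2 × y ≡ r + μ j →
            y ≡ 1 + μ i ⊎ y ≡ 2 + μ i ⊎ (∃[ r ] r ≤ 2 × y ≡ r + μ (suc i)) ⊎ μ (2 + i) ≤ y
    place (j , r , r≤2 , y≡) with ℕₚ.<-cmp j i
    ... | tri< j<i _ _ = contradiction μi<y (ℕₚ.≤⇒≯ (begin
      y              ≡⟨ y≡ ⟩
      r + μ j        ≤⟨ ℕₚ.+-monoˡ-≤ (μ j) (ℕₚ.≤-trans r≤2 2≤t) ⟩
      t + μ j        ≡⟨ trans (ℕₚ.+-comm t (μ j)) (sym (μ-suc j)) ⟩
      μ (suc j)      ≤⟨ μ-mono j<i ⟩
      μ i            ∎))
      where
      open ℕₚ.≤-Reasoning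
      2≤t : 2 ≤ t
      2≤t = s≤s (s≤s z≤n)
    place (j , _ , z≤n , y≡)             | tri≈ _ refl _ = contradiction y≡ (ℕₚ.>⇒≢ μi<y)
    place (j , _ , s≤s z≤n , y≡)         | tri≈ _ refl _ = inj₁ y≡
    place (j , _ , s≤s (s≤s z≤n) , y≡)   | tri≈ _ refl _ = inj₂ (inj₁ y≡)
    place (j , r , r≤2 , y≡) | tri> _ _ i<j with ℕₚ.m≤n⇒m<n∨m≡n i<j
    ... | inj₂ refl  = inj₂ (inj₂ (inj₁ (r , r≤2 , y≡)))
    ... | inj₁ 1+i<j = inj₂ (inj₂ (inj₂ (ℕₚ.≤-trans (μ-mono 1+i<j) (ℕₚ.≤-trans (ℕₚ.m≤n+m (μ j) r) (ℕₚ.≤-reflexive (sym y≡))))))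

  -- Since t = 3 + ρ, the residue of (r + μ (i + 1)) + (r′ + μ i) modulo 2t lies strictly between 0 and 2t.
  sum-adjacent : ∀ i r r′ → r + μ (suc i) + (r′ + μ i) ≡ r + r′ + σ + suc i * T
  sum-adjacent = lem ρ
    where
    lem : ∀ ρ i r r′ → r + ((3 + ρ) * suc i + (2 + ρ)) + (r′ + ((3 + ρ) * i + (2 + ρ)))
                     ≡ r + r′ + (1 + ρ) + suc i * (2 * (3 + ρ))
    lem = ℕ-Ring.solve-∀

  r+σ<T : ∀ {r} → r ≤ 4 → r + σ < T
  r+σ<T {r} r≤4 = begin-strict
    r + σ               ≤⟨ ℕₚ.+-monoˡ-≤ σ r≤4 ⟩
    4 + σ               ≤⟨ ℕₚ.m≤m+n (4 + σ) ρ ⟩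
    4 + σ + ρ           <⟨ ℕₚ.≤-refl ⟩
    suc (4 + σ + ρ)     ≡⟨ lem ρ ⟩
    T                   ∎
    where
    open ℕₚ.≤-Reasoning
    lem : ∀ ρ → 6 + ρ + ρ ≡ 2 * (3 + ρ)
    lem = ℕ-Ring.solve-∀

  not-separated-adjacent : ∀ i r r′ → r ≤ r′ → r + r′ ≤ 4 →
    ¬ (r + μ (suc i) ≅ 0ℤ [mod t ] × r′ + μ i ≅ 0ℤ [mod t ]) → ¬ Separated t (r + μ (suc i)) (r′ + μ i)
  not-separated-adjacent i r r′ r≤r′ ≤4 mult = not-separated close mult (suc i) (r + r′ + ρ)
    (trans (sum-adjacent i r r′) (cong (_+ suc i * T) (ℕₚ.+-suc (r + r′) ρ)))
    (ℕₚ.≤-trans (s≤s (ℕₚ.≤-reflexive (sym (ℕₚ.+-suc (r + r′) ρ)))) (r+σ<T ≤4))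
    where
    close : r + μ (suc i) ≤ r′ + μ i + t
    close = begin
      r + μ (suc i)      ≡⟨ cong (r +_) (μ-suc i) ⟩
      r + (μ i + t)      ≤⟨ ℕₚ.+-monoˡ-≤ (μ i + t) r≤r′ ⟩
      r′ + (μ i + t)     ≡⟨ ℕₚ.+-assoc r′ (μ i) t ⟨
      r′ + μ i + t       ∎
      where open ℕₚ.≤-Reasoning

  sum-pair : ∀ i → 2 + μ i + μ i ≡ suc i * T
  sum-pair i = lem τ i
    where
    lem : ∀ τ i → 2 + (suc τ * i + τ) + (suc τ * i + τ) ≡ suc i * (2 * suc τ)
    lem = ℕ-Ring.solve-∀

  not-separated-01 : ∀ i → ¬ Separated t (1 + μ i) (μ i)
  -- The sum is 2t (i + 1) - 1, with remainder 2t - 1 = 2τ + 1.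
  not-separated-01 i = not-separated close (λ (_ , p) → μ-not-multiple i p) i (τ + τ) (lem τ i)
    (ℕₚ.≤-reflexive (sym (lem₂ τ)))
    where
    close : 1 + μ i ≤ μ i + t
    close = ℕₚ.≤-trans (ℕₚ.≤-reflexive (ℕₚ.+-comm 1 (μ i))) (ℕₚ.+-monoʳ-≤ (μ i) (s≤s z≤n))
    lem : ∀ τ i → 1 + (suc τ * i + τ) + (suc τ * i + τ) ≡ suc (τ + τ) + i * (2 * suc τ)
    lem = ℕ-Ring.solve-∀
    lem₂ : ∀ τ → 2 * suc τ ≡ suc (suc (τ + τ))
    lem₂ = ℕ-Ring.solve-∀

  not-separated-12 : ∀ i → ¬ Separated t (2 + μ i) (1 + μ i)
  not-separated-12 i = not-separated close (λ (p , _) → 2+μ-not-multiple i p) (suc i) 0 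
    (trans (ℕₚ.+-suc (2 + μ i) (μ i)) (cong suc (sum-pair i))) (s≤s (s≤s z≤n))
    where
    close : 2 + μ i ≤ 1 + μ i + t
    close = s≤s (ℕₚ.≤-trans (ℕₚ.≤-reflexive (ℕₚ.+-comm 1 (μ i))) (ℕₚ.+-monoʳ-≤ (μ i) (s≤s z≤n)))

  next-μ : ∀ i {y} → SumResidue t y → Next (μ i) y ⇔ (y ≡ 2 + μ i ⊎ suc (μ (suc i)) ≤ y)
  next-μ i {y} py = mk⇔ (λ (x<y , sep) → forth (locate x<y py) sep) back
    where
    forth : y ≡ 1 + μ i ⊎ y ≡ 2 + μ i ⊎ (∃[ r ] r ≤ 2 × y ≡ r + μ (suc i)) ⊎ μ (2 + i) ≤ y →
            Separated t y (μ i) → y ≡ 2 + μ i ⊎ suc (μ (suc i)) ≤ y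
    forth (inj₁ refl) sep                                   = contradiction sep (not-separated-01 i)
    forth (inj₂ (inj₁ y≡)) _                                = inj₁ y≡
    forth (inj₂ (inj₂ (inj₁ (zero , _ , refl)))) sep        = contradiction sep
      (not-separated-adjacent i 0 0 z≤n z≤n (λ (_ , p) → μ-not-multiple i p))
    forth (inj₂ (inj₂ (inj₁ (suc r , _ , refl)))) _         = inj₂ (s≤s (ℕₚ.m≤n+m (μ (suc i)) r))
    forth (inj₂ (inj₂ (inj₂ μ≤y))) _                        = inj₂ (ℕₚ.≤-trans
      (ℕₚ.≤-trans (ℕₚ.m<m+n (μ (suc i)) z<s) (ℕₚ.≤-reflexive (sym (μ-suc (suc i))))) μ≤y)
    back : y ≡ 2 + μ i ⊎ suc (μ (suc i)) ≤ y → Next (μ i) y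
    back (inj₁ refl) = ℕₚ.n≤1+n (suc (μ i)) , inj₂ (inj₂ (≅-intro 0 (suc i) (sum-pair i)))
    back (inj₂ far)  = next-far (ℕₚ.≤-trans (ℕₚ.≤-reflexive
      (trans (sym (ℕₚ.+-assoc (μ i) t 1)) (trans (ℕₚ.+-comm (μ i + t) 1) (cong suc (sym (μ-suc i)))))) far)

  next-1+μ : ∀ i {y} → SumResidue t y → Next (1 + μ i) y ⇔ suc (μ (suc i)) ≤ y
  next-1+μ i {y} py = mk⇔ (λ (x<y , sep) → forth (locate (ℕₚ.<-trans ℕₚ.≤-refl x<y) py) x<y sep) back
    where
    forth : y ≡ 1 + μ i ⊎ y ≡ 2 + μ i ⊎ (∃[ r ] r ≤ 2 × y ≡ r + μ (suc i)) ⊎ μ (2 + i) ≤ y →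
            1 + μ i < y → Separated t y (1 + μ i) → suc (μ (suc i)) ≤ y
    forth (inj₁ refl) x<y _                                 = contradiction refl (ℕₚ.<⇒≢ x<y)
    forth (inj₂ (inj₁ refl)) _ sep                          = contradiction sep (not-separated-12 i)
    forth (inj₂ (inj₂ (inj₁ (zero , _ , refl)))) _ sep      = contradiction sep
      (not-separated-adjacent i 0 1 z≤n (s≤s z≤n) (λ (p , _) → μ-not-multiple (suc i) p))
    forth (inj₂ (inj₂ (inj₁ (suc r , _ , refl)))) _ _       = s≤s (ℕₚ.m≤n+m (μ (suc i)) r)
    forth (inj₂ (inj₂ (inj₂ μ≤y))) _ _                      = ℕₚ.≤-trans
      (ℕₚ.≤-trans (ℕₚ.m<m+n (μ (suc i)) z<s) (ℕₚ.≤-reflexive (sym (μ-suc (suc i))))) μ≤y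
    back : suc (μ (suc i)) ≤ y → Next (1 + μ i) y
    back far with ℕₚ.m≤n⇒m<n∨m≡n far
    ... | inj₂ refl   = s≤s (ℕₚ.≤-trans (ℕₚ.m<m+n (μ i) z<s) (ℕₚ.≤-reflexive (sym (μ-suc i))))
      , inj₂ (inj₁ (≅-intro 0 (2 + i) (suc-μ (suc i)) , ≅-intro 0 (suc i) (suc-μ i)))
    ... | inj₁ farther = next-far (ℕₚ.≤-trans (ℕₚ.≤-reflexive (cong suc
      (trans (sym (ℕₚ.+-assoc (μ i) t 1)) (trans (ℕₚ.+-comm (μ i + t) 1) (cong suc (sym (μ-suc i))))))) farther)

  -- The gap reaches (i + 2) t + 2, just past the next triple, so that triple is skipped entirely; 3
  -- ≤ t puts the one after it far enough away.
  next-2+μ : ∀ i {y} → SumResidue t y → Next (2 + μ i) y ⇔ μ (2 + i) ≤ y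
  next-2+μ i {y} py = mk⇔ (λ (x<y , sep) → forth (locate (ℕₚ.<-trans (ℕₚ.n≤1+n _) x<y) py) x<y sep) back
    where
    forth : y ≡ 1 + μ i ⊎ y ≡ 2 + μ i ⊎ (∃[ r ] r ≤ 2 × y ≡ r + μ (suc i)) ⊎ μ (2 + i) ≤ y →
            2 + μ i < y → Separated t y (2 + μ i) → μ (2 + i) ≤ y
    forth (inj₁ refl) x<y _                                 = contradiction (ℕₚ.<-trans ℕₚ.≤-refl x<y) (ℕₚ.<-irrefl refl)
    forth (inj₂ (inj₁ refl)) x<y _                          = contradiction x<y (ℕₚ.<-irrefl refl)
    forth (inj₂ (inj₂ (inj₁ (r , r≤2 , refl)))) _ sep       = contradiction sep
      (not-separated-adjacent i r 2 r≤2 (ℕₚ.+-monoˡ-≤ 2 r≤2) (λ (_ , p) → 2+μ-not-multiple i p))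
    forth (inj₂ (inj₂ (inj₂ μ≤y))) _ _                      = μ≤y
    back : μ (2 + i) ≤ y → Next (2 + μ i) y
    back far = next-far (begin
      2 + μ i + (t + 1)     ≡⟨ lem (μ i) ρ ⟩
      μ i + (3 + t)         ≤⟨ ℕₚ.+-monoʳ-≤ (μ i) (ℕₚ.+-monoˡ-≤ t (s≤s (s≤s (s≤s z≤n)))) ⟩
      μ i + (t + t)         ≡⟨ ℕₚ.+-assoc (μ i) t t ⟨
      μ i + t + t           ≡⟨ trans (cong (_+ t) (sym (μ-suc i))) (sym (μ-suc (suc i))) ⟩
      μ (2 + i)             ≤⟨ far ⟩
      y                     ∎)
      where
      open ℕₚ.≤-Reasoning
      lem : ∀ m ρ → 2 + m + (3 + ρ + 1) ≡ m + (3 + (3 + ρ))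
      lem = ℕ-Ring.solve-∀

  open Chains (SumResidue t) Next

  -- These enumerate the partitions with all parts at least μ i, 1 + μ i and 2 + μ i.
  G H K : ℕ → PowerSeries
  G i = f (i * 2) i i i
  H i = f (2 + i * 2) i (suc i) i
  K i = f (2 + i * 2) (suc i) (suc i) i

  -- `f-a` supplies the chains that begin with both `μ i` and `2 + μ i`, since t (2 + 2i) is the sum
  -- of the two; `f-c` supplies those in which `μ i` stands without its partner.
  G-rule : ∀ i → G i ≈ H i +ˢ μ i ▷ (H (suc i) +ˢ (2 + μ i) ▷ G (2 + i))
  G-rule i n = begin
    G i n
      ≡⟨ f-a (i * 2) i i i n ⟩
    f (2 + i * 2) i i i n ℤ.+ (t * (2 + i * 2) ▷ G (2 + i)) n
      ≡⟨ cong₂ ℤ._+_ (f-c (2 + i * 2) i i i n) (▷-≡ (G (2 + i)) (lem τ i) n) ⟩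
    H i n ℤ.+ (μ i ▷ H (suc i)) n ℤ.+ ((μ i + (2 + μ i)) ▷ G (2 + i)) n
      ≡⟨ ℤₚ.+-assoc (H i n) _ _ ⟩
    H i n ℤ.+ ((μ i ▷ H (suc i)) n ℤ.+ ((μ i + (2 + μ i)) ▷ G (2 + i)) n)
      ≡⟨ cong (λ z → H i n ℤ.+ z) (▷-expand (μ i) (2 + μ i) {g₁ = H (suc i)} {g₂ = G (2 + i)} (λ _ → refl) n) ⟨
    H i n ℤ.+ (μ i ▷ (H (suc i) +ˢ (2 + μ i) ▷ G (2 + i))) n ∎
    where
    open ≡-Reasoning
    lem : ∀ τ i → suc τ * (2 + i * 2) ≡ suc τ * i + τ + (2 + (suc τ * i + τ))
    lem = ℕ-Ring.solve-∀

  H-rule : ∀ i → H i ≈ K i +ˢ suc (μ i) ▷ H (suc i)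
  H-rule i = f-b (2 + i * 2) i (suc i) i

  K-rule : ∀ i → K i ≈ G (suc i) +ˢ (2 + μ i) ▷ G (2 + i)
  K-rule i = f-d (2 + i * 2) (suc i) (suc i) i

  ≤-split : ∀ {m y} → m ≤ y ⇔ (y ≡ m ⊎ suc m ≤ y)
  ≤-split = mk⇔ ([ inj₂ , inj₁ ∘ sym ]′ ∘ ℕₚ.m≤n⇒m<n∨m≡n) [ ℕₚ.≤-reflexive ∘ sym , ℕₚ.<⇒≤ ]′

  2+μ<μ-suc : ∀ i → 2 + μ i < μ (suc i)
  2+μ<μ-suc i = ℕₚ.≤-trans (ℕₚ.≤-trans (ℕₚ.≤-reflexive (ℕₚ.+-comm 3 (μ i)))
    (ℕₚ.+-monoʳ-≤ (μ i) (s≤s (s≤s (s≤s z≤n))))) (ℕₚ.≤-reflexive (sym (μ-suc i)))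

  ≥2+μ-split : ∀ i {y} → SumResidue t y → (y ≡ 2 + μ i ⊎ μ (suc i) ≤ y) ⇔ 2 + μ i ≤ y
  ≥2+μ-split i {y} py = mk⇔ [ ℕₚ.≤-reflexive ∘ sym , ℕₚ.≤-trans (ℕₚ.<⇒≤ (2+μ<μ-suc i)) ]′
    λ 2+μ≤y → forth 2+μ≤y (locate (ℕₚ.≤-trans (ℕₚ.n≤1+n _) 2+μ≤y) py)
    where
    forth : 2 + μ i ≤ y → y ≡ 1 + μ i ⊎ y ≡ 2 + μ i ⊎ (∃[ r ] r ≤ 2 × y ≡ r + μ (suc i)) ⊎ μ (2 + i) ≤ y →
            y ≡ 2 + μ i ⊎ μ (suc i) ≤ y
    forth 2+μ≤y (inj₁ refl)                          = contradiction 2+μ≤y ℕₚ.1+n≰n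
    forth _     (inj₂ (inj₁ y≡))                     = inj₁ y≡
    forth _     (inj₂ (inj₂ (inj₁ (r , _ , refl))))  = inj₂ (ℕₚ.m≤n+m (μ (suc i)) r)
    forth _     (inj₂ (inj₂ (inj₂ μ≤y)))             = inj₂ (ℕₚ.≤-trans (μ-mono (ℕₚ.n≤1+n (suc i))) μ≤y)

  module _ (N : ℕ) where

    EnumG EnumH : ℕ → Set
    EnumG i = Enumerates N (Chain (μ i ≤_)) (G i)
    EnumH i = Enumerates N (Chain (suc (μ i) ≤_)) (H i)

    -- Needed twice: for `K`, where `2 + μ i` may be the smallest part, and inside `G`, where it may
    -- follow `μ i`.
    enum-2+ : ∀ i {B g} → Enumerates N (Chain B) g → (∀ {y} → B y → 2 + μ i < y) → EnumG (2 + i) →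
              Enumerates N (Chain (λ y → y ≡ 2 + μ i ⊎ B y)) (g +ˢ (2 + μ i) ▷ G (2 + i))
    enum-2+ i e B⇒> eG = enum-part (2 + μ i) (part-2+μ i) (λ b → ℕₚ.<-irrefl refl (B⇒> b)) e
      (enum-⇔ (λ py → ⇔-sym (next-2+μ i py)) eG)

    enum-step : ∀ i → EnumG (suc i) → EnumG (2 + i) → EnumH (suc i) → EnumG i × EnumH i
    enum-step i eG₁ eG₂ eH₁ = eG₀ , eH₀
      where
      eK₀ : Enumerates N (Chain (2 + μ i ≤_)) (K i)
      eK₀ = enum-agree (≈⇒agree (≈-sym (K-rule i)))
        (enum-⇔ (≥2+μ-split i) (enum-2+ i eG₁ (ℕₚ.≤-trans (2+μ<μ-suc i)) eG₂))
      eH₀ : EnumH i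
      eH₀ = enum-agree (≈⇒agree (≈-sym (H-rule i))) (enum-⇔ (λ _ → ⇔-sym ≤-split)
        (enum-part (1 + μ i) (part-1+μ i) ℕₚ.1+n≰n eK₀ (enum-⇔ (λ py → ⇔-sym (next-1+μ i py)) eH₁)))
      eG₀ : EnumG i
      eG₀ = enum-agree (≈⇒agree (≈-sym (G-rule i))) (enum-⇔ (λ _ → ⇔-sym ≤-split)
        (enum-part (μ i) (part-μ i) ℕₚ.1+n≰n eH₀ (enum-⇔ (λ py → ⇔-sym (next-μ i py))
          (enum-2+ i eH₁ (ℕₚ.≤-trans (s≤s (ℕₚ.<⇒≤ (2+μ<μ-suc i)))) eG₂))))

    N≤i⇒N≤μ : ∀ {i} → N ≤ i → N ≤ μ i
    N≤i⇒N≤μ {i} N≤i = ℕₚ.≤-trans N≤i (ℕₚ.<⇒≤ (i<μ i))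

    -- Base of the downward induction on `i`: below degree `N` the series are 1, and only the empty
    -- chain is small enough.
    enum-large : ∀ i → N ≤ i → EnumG i × EnumH i
    enum-large i N≤i =
      enum-agree (λ n n<N → sym (f-limit (below n<N N≤2i) (below n<N N≤i) (below n<N N≤i) (below n<N N≤i)))
        (enum-empty λ _ → ℕₚ.≤-trans (N≤i⇒N≤μ N≤i))
      , enum-agree (λ n n<N → sym (f-limit (below n<N (ℕₚ.≤-trans N≤2i (ℕₚ.m≤n+m _ 2))) (below n<N N≤i)
          (below n<N (ℕₚ.m≤n⇒m≤1+n N≤i)) (below n<N N≤i)))
        (enum-empty λ _ → ℕₚ.≤-trans (ℕₚ.m≤n⇒m≤1+n (N≤i⇒N≤μ N≤i)))
      where
      N≤2i : N ≤ i * 2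
      N≤2i = ℕₚ.≤-trans N≤i (ℕₚ.m≤m*n i 2)
      below : ∀ {n m} → n < N → N ≤ m → n < m
      below = ℕₚ.≤-trans

    -- `φ` bounds the distance from `i` up to `N`; the recurrences refer to i + 1 and i + 2, where a
    -- smaller bound suffices.
    enum-all : ∀ φ i → N ≤ φ + i → EnumG i × EnumH i
    enum-all zero    i N≤ = enum-large i N≤
    enum-all (suc φ) i N≤ =
      let (eG₁ , eH₁) = enum-all φ (suc i) N≤′
          (eG₂ , _)   = enum-all φ (2 + i) (ℕₚ.≤-trans N≤′ (ℕₚ.+-monoʳ-≤ φ (ℕₚ.n≤1+n (suc i))))
      in enum-step i eG₁ eG₂ eH₁
      where
      N≤′ : N ≤ φ + suc i
      N≤′ = ℕₚ.≤-trans N≤ (ℕₚ.≤-reflexive (sym (ℕₚ.+-suc φ i)))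

  SumPartition : ℕ → List ℕ → Set
  SumPartition n ps = DistinctPartition n ps × SumClass t ps

  μ₀≤part : ∀ {y} → 1 < y → SumResidue t y → μ 0 ≤ y
  μ₀≤part 1<y py with part-form 1<y py
  ... | j , r , _ , refl = ℕₚ.≤-trans (μ-mono {0} {j} z≤n) (ℕₚ.m≤n+m (μ j) r)

  -- The recurrences prepend the smallest part, whereas partitions list the largest first; hence the
  -- reversal.
  chain⇒partition : ∀ n qs → sum qs ≡ n × Chain (μ 0 ≤_) qs → SumPartition n (reverse qs)
  chain⇒partition n qs (s , c) =
    ( linked-reverse (Linked.map proj₁ linked)
    , all-reverse (All.map (ℕₚ.≤-trans (s≤s z≤n)) large)
    , trans (sum-reverse qs) s)
    , all-reverse large , all-reverse (chain-parts qs c) , linked-reverse (Linked.map proj₂ linked)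
    where
    linked : Linked Next qs
    linked = chain-linked qs c
    1<μ₀ : 1 < μ 0
    1<μ₀ = ℕₚ.≤-trans (s≤s (s≤s z≤n)) (τ≤μ 0)
    large : All (1 <_) qs
    large = chain-all (ℕₚ.<-≤-trans 1<μ₀) (λ 1<x (x<y , _) → ℕₚ.<-trans 1<x x<y) qs c

  partition⇒chain : ∀ n ps → SumPartition n ps → sum (reverse ps) ≡ n × Chain (μ 0 ≤_) (reverse ps)
  partition⇒chain n ps ((decreasing , _ , s) , large , parts , separated) =
    trans (sum-reverse ps) s
    , chain-intro (reverse ps)
        (all-reverse (All.zipWith (λ (1<y , py) → μ₀≤part 1<y py) (large , parts)))
        (all-reverse parts) (linked-reverse (Linked.zip (decreasing , separated)))

  sumGF : IsGeneratingFunction (SumClass t) (f 0 0 0 0)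
  sumGF n = counts-⇔ equivalence (counts-map reverse Listₚ.reverse-injective
    (proj₁ (enum-all (suc n) (suc n) 0 (ℕₚ.m≤m+n (suc n) 0)) n ℕₚ.≤-refl))
    where
    equivalence : ∀ ps → (∃[ qs ] ps ≡ reverse qs × sum qs ≡ n × Chain (μ 0 ≤_) qs) ⇔ SumPartition n ps
    equivalence ps = mk⇔ (λ { (qs , refl , c) → chain⇒partition n qs c })
      λ p → reverse ps , sym (Listₚ.reverse-involutive ps) , partition⇒chain n ps p

theorem6 : ∀ (t : ℕ) → t > 3 →
    ∃[ F ] HasProduct (λ k → productFactor t (suc k)) F
    × HasSum (summand t) F
    × IsGeneratingFunction (ProductClass t) F
    × IsGeneratingFunction (SumClass t) F
-- With t = ρ + 3 the modules receive t - 1, t - 2 or t - 3, and all of them refer to the same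
-- series `f 0 0 0 0`.
theorem6 (suc (suc (suc ρ))) _ =
  SumSide.f (2 + ρ) z<s 0 0 0 0
  , ProductLimit.hasProduct (suc ρ)
  , SumSide.hasSum (2 + ρ) z<s
  , ProductPartitions.productGF (suc ρ)
  , SumPartitions.sumGF ρ
theorem6 (suc zero) (s≤s ())
theorem6 (suc (suc zero)) (s≤s (s≤s ()))
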